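{- Let $M$ be an ultrahomogeneous structure (in a countable relational language). Then: (1) if $M$ has the fixed points on type spaces property (FPT), then $M$ has the externally definable Ramsey property; (2) if $\mathrm{Age}(M)$ is countable up to isomorphism, then $M$ has the externally definable Ramsey property if and only if $M$ has FPT.
   Context: All first-order languages are countable and relational. A structure $M$ is ultrahomogeneous if every isomorphism between finite substructures of $M$ extends to an automorphism of $M$. $\mathrm{Age}(M)$ is the class of finite structures embeddable in $M$; it is countable if its members lie in countably many isomorphism classes. Externally definable Ramsey property. Writing $\bar a\in\mathrm{Age}(M)$ means a structure $A\in\mathrm{Age}(M)$ together with an enumeration $\bar a$ (without repetition) of its elements. For a structure $B$, $\binom{B}{\bar a}=\{f(\bar a): f:A\to B \text{ an embedding}\}$. A $k$-colouring of $\binom{M}{\bar a}$ is a function $\chi:\binom{M}{\bar a}\to k=\{0,\dots,k-1\}$. It is externally definable if there are an elementary extension $N\succeq M$, a finite tuple $\bar e$ in $N$ and formulae $\phi_0(\bar x,\bar y),\dots,\phi_{k-1}(\bar x,\bar y)$ (no parameters) such that for all $\bar a'\in\binom{M}{\bar a}$ and $i<k$: $\chi(\bar a')=i\iff N\models\phi_i(\bar e,\bar a')$. $M$ has the externally definable Ramsey property if for all $\bar a\in\mathrm{Age}(M)$, all $k\ge 1$, all $B\in\mathrm{Age}(M)$ and every externally definable $\chi:\binom{M}{\bar a}\to k$, there is a substructure $B'\subseteq M$ with $B'\cong B$ such that $\chi$ is constant on $\binom{B'}{\bar a}$. FPT. Let $G=\mathrm{Aut}(M)$ with the pointwise convergence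 topology. $G$ acts continuously on the Stone space $S_n(M)$ of complete $n$-types over $M$ by $g\cdot p(\bar x)=\{\phi(\bar x,g\bar m):\phi(\bar x,\bar m)\in p(\bar x)\}$. A subflow of $S_n(M)$ is a non-empty closed $G$-invariant subset with the restricted action. $M$ has FPT if for every $n\ge1$ every subflow of $S_n(M)$ contains a $G$-fixed point. -}

module Defs where

open import Data.Fin.Base using (Fin)
open import Data.List.Base using (List; []; _∷_)
open import Data.List.Relation.Unary.All using (All; []; _∷_)
open import Data.Nat.Base using (ℕ; suc; _+_; _≤_)
open import Data.Product.Base using (∃-syntax; Σ-syntax; _×_; _,_; proj₁)
open import Data.Refinement using (Refinement-syntax; value; value-injective)
open import Data.Sum.Base using (_⊎_; inj₁; inj₂)
open import Data.Vec.Base using (Vec; []; _∷_; _++_; map; lookup)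
open import Data.Vec.Membership.Propositional using () renaming (_∈_ to _∈ᵥ_)
open import Data.Vec.Properties using (map-∘; map-id; map-cong; lookup-map; map-++)
open import Data.Vec.Relation.Unary.Unique.Propositional using (Unique)
open import Data.Empty.Polymorphic using (⊥)
open import Function.Base using (_∘_; id)
open import Function.Bundles using
  (_↣_; _↔_; _⇔_; mk⇔; mk↣; module Injection; module Inverse; module Equivalence)
open import Level using (Level) renaming (suc to lsuc)
open import Relation.Binary.PropositionalEquality
  using (_≡_; refl; sym; trans; cong; subst)
open import Relation.Unary using (Pred; _∈_; _⊆_; _≐_; ∁; Satisfiable)

private
  variable
    ℓ : Level

record Language : Set₁ where
  field
    Symbol    : Set
    arity     : Symbol → ℕ
    countable : Symbol ↣ ℕ

open Language public

record Structure (L : Language) (ℓ : Level) : Set (lsuc ℓ) where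
  field
    Carrier : Set ℓ
    rel     : (R : Symbol L) → Pred (Vec Carrier (arity L R)) ℓ

open Structure public

module _ {L : Language} where

  record Embedding (A B : Structure L ℓ) : Set ℓ where
    field
      injection : Carrier A ↣ Carrier B

    open Injection injection public using (to; injective)

    field
      preserves : ∀ R xs → rel A R xs ⇔ rel B R (map to xs)

  record _≅_ (A B : Structure L ℓ) : Set ℓ where
    field
      inverse : Carrier A ↔ Carrier B

    open Inverse inverse public using (to; from; strictlyInverseˡ; strictlyInverseʳ)

    field
      preserves : ∀ R xs → rel A R xs ⇔ rel B R (map to xs)

  infix 4 _≅_

  Automorphism : Structure L ℓ → Set ℓ
  Automorphism M = M ≅ M

-- The language is relational, so every subset carries a substructure.
-- The membership proof in a refinement is irrelevant: two elements of
-- M ↾ P are equal as soon as their values are.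

  _↾_ : (M : Structure L ℓ) → Pred (Carrier M) ℓ → Structure L ℓ
  M ↾ P = record
    { Carrier = [ x ∈ Carrier M ∣ P x ]
    ; rel     = λ R xs → rel M R (map value xs)
    }

  inclusion : (M : Structure L ℓ) (P : Pred (Carrier M) ℓ) → Embedding (M ↾ P) M
  inclusion M P = record
    { injection = mk↣ {to = value} value-injective
    ; preserves = λ R xs → mk⇔ id id
    }

record Enumeration (A : Set ℓ) : Set ℓ where
  field
    size       : ℕ
    tuple      : Vec A size
    unique     : Unique tuple
    exhaustive : ∀ x → x ∈ᵥ tuple

open Enumeration public

module _ {L : Language} where

  Finite : Structure L ℓ → Set ℓ
  Finite A = Enumeration (Carrier A)

  Age : Structure L ℓ → Pred (Structure L ℓ) ℓ
  Age M A = Finite A × Embedding A M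

  -- Any sequence of structures listing the age up to isomorphism will do;
  -- repetitions are allowed.
  AgeCountable : Structure L ℓ → Set (lsuc ℓ)
  AgeCountable {ℓ} M =
    Σ[ F ∈ (ℕ → Structure L ℓ) ] (∀ A → A ∈ Age M → ∃[ i ] A ≅ F i)

  Ultrahomogeneous : Structure L ℓ → Set (lsuc ℓ)
  Ultrahomogeneous {ℓ} M =
    (P Q : Pred (Carrier M) ℓ) → Finite (M ↾ P) → Finite (M ↾ Q) →
    (f : (M ↾ P) ≅ (M ↾ Q)) →
    Σ[ g ∈ Automorphism M ] (∀ x → _≅_.to g (value x) ≡ value (_≅_.to f x))

-- Formula L n: formulae with free variables among n variables.  In the
-- scope of all′ the bound variable is variable zero.  Classically these
-- connectives define all the others.

data Formula (L : Language) : ℕ → Set where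
  rel′ : ∀ {n} (R : Symbol L) → Vec (Fin n) (arity L R) → Formula L n
  eq′  : ∀ {n} → Fin n → Fin n → Formula L n
  ⊥′   : ∀ {n} → Formula L n
  _⇒′_ : ∀ {n} → Formula L n → Formula L n → Formula L n
  all′ : ∀ {n} → Formula L (suc n) → Formula L n

infixr 6 _⇒′_

¬′_ : ∀ {L n} → Formula L n → Formula L n
¬′ φ = φ ⇒′ ⊥′

module _ {L : Language} where

  infix 4 _⊨_at_

  _⊨_at_ : (M : Structure L ℓ) → ∀ {n} → Formula L n → Vec (Carrier M) n → Set ℓ
  M ⊨ rel′ R xs at ρ = rel M R (map (lookup ρ) xs)
  M ⊨ eq′ x y   at ρ = lookup ρ x ≡ lookup ρ y
  M ⊨ ⊥′        at ρ = ⊥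
  M ⊨ φ ⇒′ ψ    at ρ = M ⊨ φ at ρ → M ⊨ ψ at ρ
  M ⊨ all′ φ    at ρ = ∀ a → M ⊨ φ at (a ∷ ρ)

  -- M ≼ N: N is an elementary extension of M, where M is identified with
  -- its image under the elementary map.
  record _≼_ (M N : Structure L ℓ) : Set ℓ where
    field
      embed      : Carrier M → Carrier N
      elementary : ∀ {n} (φ : Formula L n) (ρ : Vec (Carrier M) n) →
                   M ⊨ φ at ρ ⇔ N ⊨ φ at (map embed ρ)

  infix 4 _≼_

  -- The set (B choose ā): the tuples f(ā) for embeddings f : A → B.
  Copies : (B A : Structure L ℓ) → Enumeration (Carrier A) → Set ℓ
  Copies B A ā =
    Σ[ t ∈ Vec (Carrier B) (size ā) ]
    Σ[ f ∈ Embedding A B ] map (Embedding.to f) (tuple ā) ≡ t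

  _∘ₑ_ : {A B C : Structure L ℓ} → Embedding B C → Embedding A B → Embedding A C
  _∘ₑ_ {C = C} g f = record
    { injection = mk↣ {to = G.to ∘ F.to} (F.injective ∘ G.injective)
    ; preserves = λ R xs → mk⇔
        (subst (rel C R) (sym (map-∘ G.to F.to xs))
          ∘ Equivalence.to (G.preserves R _) ∘ Equivalence.to (F.preserves R xs))
        (Equivalence.from (F.preserves R xs) ∘ Equivalence.from (G.preserves R _)
          ∘ subst (rel C R) (map-∘ G.to F.to xs))
    }
    where module F = Embedding f
          module G = Embedding g

  pushCopy : {B C : Structure L ℓ} → Embedding B C →
             (A : Structure L ℓ) (ā : Enumeration (Carrier A)) →
             Copies B A ā → Copies C A ā
  pushCopy g A ā (t , f , e) =
    map (Embedding.to g) t , g ∘ₑ f ,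
    trans (map-∘ (Embedding.to g) (Embedding.to f) (tuple ā)) (cong (map _) e)

  -- An externally definable χ depends only on the tuple of a copy, not on
  -- the embedding witnessing it, since the right-hand side of defines does.
  record ExternallyDefinable (M A : Structure L ℓ) (ā : Enumeration (Carrier A)) {k : ℕ}
                             (χ : Copies M A ā → Fin k) : Set (lsuc ℓ) where
    field
      N         : Structure L ℓ
      extension : M ≼ N
      {m}       : ℕ
      ē         : Vec (Carrier N) m
      φ         : Fin k → Formula L (m + size ā)
      defines   : ∀ c i →
                  (χ c ≡ i) ⇔ (N ⊨ φ i at (ē ++ map (_≼_.embed extension) (proj₁ c)))

  EDRamsey : Structure L ℓ → Set (lsuc ℓ)
  EDRamsey {ℓ} M =
    (A : Structure L ℓ) → A ∈ Age M → (ā : Enumeration (Carrier A)) →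
    (k : ℕ) → 1 ≤ k →
    (B : Structure L ℓ) → B ∈ Age M →
    (χ : Copies M A ā → Fin k) → ExternallyDefinable M A ā χ →
    Σ[ P ∈ Pred (Carrier M) ℓ ] ((M ↾ P) ≅ B) ×
      (∀ (c d : Copies (M ↾ P) A ā) →
        χ (pushCopy (inclusion M P) A ā c) ≡ χ (pushCopy (inclusion M P) A ā d))

  -- φ(x̄, m̄) with n free variables x̄ and a tuple of parameters m̄ from M.
  -- The same formula over M has several presentations (unused or permuted
  -- parameters); a type as defined below cannot separate them.
  record FormulaOver (M : Structure L ℓ) (n : ℕ) : Set ℓ where
    no-eta-equality
    pattern
    constructor _[_]
    field
      {#params}  : ℕ
      formula    : Formula L (n + #params)
      parameters : Vec (Carrier M) #params

  open FormulaOver public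

  notOver : {M : Structure L ℓ} {n : ℕ} → FormulaOver M n → FormulaOver M n
  notOver (φ [ m̄ ]) = (¬′ φ) [ m̄ ]

  Realises : (M : Structure L ℓ) {n : ℕ} → Vec (Carrier M) n → Pred (FormulaOver M n) ℓ
  Realises M x̄ (φ [ m̄ ]) = M ⊨ φ at (x̄ ++ m̄)

  -- The complete n-types over M: the complete sets of formulae over M that
  -- are finitely satisfiable in M, i.e. consistent with the elementary
  -- diagram of M.
  record S (n : ℕ) (M : Structure L ℓ) : Set (lsuc ℓ) where
    field
      formulae             : Pred (FormulaOver M n) ℓ
      finitely-satisfiable : (Δ : List (FormulaOver M n)) → All formulae Δ →
                             ∃[ x̄ ] All (Realises M x̄) Δ
      complete             : ∀ φ → φ ∈ formulae ⊎ notOver φ ∈ formulae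

  open S public

  ≅-⊨ : {M N : Structure L ℓ} (g : M ≅ N) {n : ℕ} (φ : Formula L n) (ρ : Vec (Carrier M) n) →
        M ⊨ φ at ρ ⇔ N ⊨ φ at (map (_≅_.to g) ρ)
  ≅-⊨ {M = M} {N} g (rel′ R xs) ρ =
    subst (λ v → M ⊨ rel′ R xs at ρ ⇔ rel N R v)
      (trans (sym (map-∘ _ _ xs)) (map-cong (λ i → sym (lookup-map i _ ρ)) xs))
      (_≅_.preserves g R (map (lookup ρ) xs))
  ≅-⊨ g (eq′ x y) ρ = mk⇔
    (λ e → trans (lookup-map x _ ρ) (trans (cong to e) (sym (lookup-map y _ ρ))))
    (λ e → trans (sym (strictlyInverseʳ _)) (trans
      (cong from (trans (sym (lookup-map x _ ρ)) (trans e (lookup-map y _ ρ))))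
      (strictlyInverseʳ _)))
    where open _≅_ g
  ≅-⊨ g ⊥′ ρ = mk⇔ (λ ()) (λ ())
  ≅-⊨ g (φ ⇒′ ψ) ρ = mk⇔
    (λ h → Equivalence.to (≅-⊨ g ψ ρ) ∘ h ∘ Equivalence.from (≅-⊨ g φ ρ))
    (λ h → Equivalence.from (≅-⊨ g ψ ρ) ∘ h ∘ Equivalence.to (≅-⊨ g φ ρ))
  ≅-⊨ {N = N} g (all′ φ) ρ = mk⇔
    (λ h b → subst (λ c → N ⊨ φ at (c ∷ map to ρ)) (strictlyInverseˡ b)
               (Equivalence.to (≅-⊨ g φ (from b ∷ ρ)) (h (from b))))
    (λ h a → Equivalence.from (≅-⊨ g φ (a ∷ ρ)) (h (to a)))
    where open _≅_ g

  translate : {M : Structure L ℓ} {n : ℕ} → Automorphism M → FormulaOver M n → FormulaOver M n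
  translate g (φ [ m̄ ]) = φ [ map (_≅_.to g) m̄ ]

  module _ {M : Structure L ℓ} {n : ℕ} (g : Automorphism M) where

    open _≅_ g

    private
      Image : Pred (FormulaOver M n) ℓ → Pred (FormulaOver M n) ℓ
      Image p ψ = ∃[ φ ] φ ∈ p × translate g φ ≡ ψ

      translate-Realises : ∀ x̄ (φ : FormulaOver M n) → Realises M x̄ φ →
                           Realises M (map to x̄) (translate g φ)
      translate-Realises x̄ (φ [ m̄ ]) h =
        subst (M ⊨ φ at_) (map-++ to x̄ m̄) (Equivalence.to (≅-⊨ g φ (x̄ ++ m̄)) h)

      preimages : ∀ p Δ → All (Image p) Δ → List (FormulaOver M n)
      preimages p [] [] = []
      preimages p (_ ∷ Δ) ((φ , _) ∷ hs) = φ ∷ preimages p Δ hs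

      preimages-∈ : ∀ p Δ hs → All p (preimages p Δ hs)
      preimages-∈ p [] [] = []
      preimages-∈ p (_ ∷ Δ) ((_ , h , _) ∷ hs) = h ∷ preimages-∈ p Δ hs

      preimages-Realises : ∀ p Δ hs x̄ → All (Realises M x̄) (preimages p Δ hs) →
                           All (Realises M (map to x̄)) Δ
      preimages-Realises p [] [] x̄ [] = []
      preimages-Realises p (_ ∷ Δ) ((φ , _ , refl) ∷ hs) x̄ (r ∷ rs) =
        translate-Realises x̄ φ r ∷ preimages-Realises p Δ hs x̄ rs

      to-from : ∀ {k} (m̄ : Vec (Carrier M) k) → map to (map from m̄) ≡ m̄
      to-from m̄ = trans (sym (map-∘ to from m̄)) (trans (map-cong strictlyInverseˡ m̄) (map-id m̄))

    -- g · p = { φ(x̄, g m̄) : φ(x̄, m̄) ∈ p }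
    _·_ : S n M → S n M
    _·_ p = record
      { formulae             = Image (formulae p)
      ; finitely-satisfiable = λ Δ hs →
          let Δ′ = preimages (formulae p) Δ hs
              (x̄ , rs) = finitely-satisfiable p Δ′ (preimages-∈ (formulae p) Δ hs)
          in map to x̄ , preimages-Realises (formulae p) Δ hs x̄ rs
      ; complete             = λ where
          (φ [ m̄ ]) → complete-at φ m̄ (complete p (φ [ map from m̄ ]))
      }
      where
      complete-at : ∀ {k} (φ : Formula L (n + k)) (m̄ : Vec (Carrier M) k) →
        φ [ map from m̄ ] ∈ formulae p ⊎ (¬′ φ) [ map from m̄ ] ∈ formulae p →
        φ [ m̄ ] ∈ Image (formulae p) ⊎ (¬′ φ) [ m̄ ] ∈ Image (formulae p)
      complete-at φ m̄ (inj₁ h) = inj₁ (_ , h , cong (φ [_]) (to-from m̄))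
      complete-at φ m̄ (inj₂ h) = inj₂ (_ , h , cong ((¬′ φ) [_]) (to-from m̄))

  ⟦_⟧ : {M : Structure L ℓ} {n : ℕ} → FormulaOver M n → Pred (S n M) ℓ
  ⟦ φ ⟧ p = φ ∈ formulae p

  -- The Stone topology; its basic open sets ⟦ φ ⟧ are closed under finite
  -- intersections.
  Open : {M : Structure L ℓ} {n : ℕ} → Pred (S n M) ℓ → Set (lsuc ℓ)
  Open U = ∀ p → p ∈ U → ∃[ φ ] p ∈ ⟦ φ ⟧ × ⟦ φ ⟧ ⊆ U

  Closed : {M : Structure L ℓ} {n : ℕ} → Pred (S n M) ℓ → Set (lsuc ℓ)
  Closed X = Open (∁ X)

  record IsSubflow {M : Structure L ℓ} {n : ℕ} (X : Pred (S n M) ℓ) : Set (lsuc ℓ) where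
    field
      nonempty  : Satisfiable X
      closed    : Closed X
      invariant : (g : Automorphism M) → ∀ p → p ∈ X → (g · p) ∈ X

  -- Types are sets of formulae, hence compared extensionally.
  Fixed : {M : Structure L ℓ} {n : ℕ} → Pred (S n M) ℓ
  Fixed {M = M} p = (g : Automorphism M) → formulae (g · p) ≐ formulae p

  FPT : Structure L ℓ → Set (lsuc ℓ)
  FPT {ℓ} M = (n : ℕ) → 1 ≤ n → (X : Pred (S n M) ℓ) → IsSubflow X →
              ∃[ p ] p ∈ X × p ∈ Fixed

{-# OPTIONS --safe #-}

-- Excluded middle for types is a choice operator, so Zorn-style arguments are available; they
-- give ultrafilters, ultrapowers (hence realisations of types over M in elementary extensions)
-- and ultralimits of types, which stay in every closed set containing the types of the family.
--
-- FPT gives the Ramsey property: an externally definable colouring is read off the type p over M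
-- of the defining tuple.  By ultrahomogeneity all copies of ā in M are in one orbit, so a fixed
-- point q in the closure of the orbit of p treats them alike; on the finitely many instances of
-- the colouring formulae in a copy of B some translate g · p agrees with q, so g⁻¹ B is
-- monochromatic.
--
-- Conversely, let X be a subflow and φ(x̄, m̄) a formula over M.  Realising some p ∈ X in an
-- elementary extension turns φ into an externally definable colouring of the copies of m̄; a
-- monochromatic copy of each finite part of M yields translates of p on which φ is constant
-- along the orbit of m̄ in that part, and an ultralimit of them lies in X and is constant along the
-- whole orbit.  The q ∈ X constant along that orbit therefore form a subflow.  Iterating this over
-- finite sets of formulae and taking one more ultralimit gives a point of X constant along every
-- orbit, that is, a fixed point.

module Submission where

open import Defs
open import Axiom.ExcludedMiddle using (ExcludedMiddle)
open import Axiom.Extensionality.Propositional using (Extensionality)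
open import Data.Bool.Base using (Bool; true; false; T)
open import Data.Fin.Base using (Fin; zero; suc; _↑ˡ_; _↑ʳ_)
open import Data.Irrelevant using () renaming ([_] to irr)
open import Data.List.Base as List using (List; []; _∷_)
import Data.List.Membership.Propositional as List∈
open import Data.List.Membership.Propositional.Properties
  using (∈-++⁺ˡ; ∈-++⁺ʳ; ∈-map⁺; ∈-allFin; ∈-cartesianProductWith⁺)
import Data.List.Relation.Binary.Subset.Propositional as List⊆
open import Data.List.Relation.Unary.All as All using (All; []; _∷_)
import Data.List.Relation.Unary.All.Properties as Allₚ
open import Data.List.Relation.Unary.Any using (here; there)
open import Data.Nat.Base using (ℕ; zero; suc; _+_; z≤n; s≤s)
open import Data.Product.Base using (∃-syntax; Σ-syntax; _×_; _,_; proj₁; proj₂)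
open import Data.Refinement using (Refinement-syntax; value; value-injective; _,_)
open import Data.Sum.Base using (_⊎_; inj₁; inj₂; [_,_]′)
open import Data.Vec.Base
  using (Vec; []; _∷_; _++_; map; lookup; allFin; tabulate; fromList; toList)
open import Data.Vec.Membership.Propositional using () renaming (_∈_ to _∈ᵥ_)
import Data.Vec.Membership.Propositional.Properties as Vec∈
open import Data.Vec.Properties
  using (map-∘; map-id; map-cong; map-++; lookup-map; lookup-++ˡ; lookup-++ʳ; map-lookup-allFin;
         tabulate∘lookup; tabulate-∘; tabulate-cong)
import Data.Vec.Relation.Unary.All.Properties as VecAllₚ
import Data.Vec.Relation.Unary.AllPairs as AllPairs
import Data.Vec.Relation.Unary.Any as VecAny
import Data.Vec.Relation.Unary.Any.Properties as VecAnyₚ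
open import Data.Vec.Relation.Unary.Unique.Propositional using (Unique)
open import Data.Vec.Relation.Unary.Unique.Propositional.Properties
  using () renaming (map⁺ to unique-map⁺)
open import Function.Base using (_∘_; id; case_of_)
open import Function.Bundles using (_⇔_; mk⇔; mk↣; mk↔ₛ′; module Equivalence)
open import Level using (Level; 0ℓ; Lift; lift; lower) renaming (suc to lsuc)
open import Relation.Binary.PropositionalEquality
  using (_≡_; refl; sym; trans; cong; cong₂; subst; module ≡-Reasoning)
open import Relation.Binary.Structures using (IsEquivalence)
open import Relation.Nullary using (¬_; Dec; yes; no; contradiction)
open import Relation.Nullary.Decidable
  using (isYes; toWitness; fromWitness; recompute; decidable-stable)
open import Relation.Unary using (Pred; _∈_; ∁)

open Equivalence using (to; from)

private
  variable
    ℓ : Level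
    L : Language
    n r s : ℕ

-- Formulae

≡⇒⇔ : {A B : Set ℓ} → A ≡ B → A ⇔ B
≡⇒⇔ refl = mk⇔ id id

rename : Vec (Fin s) r → Formula L r → Formula L s
rename v (rel′ R xs) = rel′ R (map (lookup v) xs)
rename v (eq′ x y)   = eq′ (lookup v x) (lookup v y)
rename v ⊥′          = ⊥′
rename v (φ ⇒′ ψ)    = rename v φ ⇒′ rename v ψ
rename v (all′ φ)    = all′ (rename (zero ∷ map suc v) φ)

rename-⊨ : (N : Structure L ℓ) (φ : Formula L r) (v : Vec (Fin s) r) (ρ : Vec (Carrier N) s) →
           N ⊨ rename v φ at ρ ⇔ N ⊨ φ at map (lookup ρ) v
rename-⊨ N (rel′ R xs) v ρ = ≡⇒⇔ (cong (rel N R) (trans (sym (map-∘ _ _ xs))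
  (map-cong (λ x → sym (lookup-map x _ v)) xs)))
rename-⊨ N (eq′ x y) v ρ =
  ≡⇒⇔ (cong₂ _≡_ (sym (lookup-map x _ v)) (sym (lookup-map y _ v)))
rename-⊨ N ⊥′ v ρ = mk⇔ id id
rename-⊨ N (φ ⇒′ ψ) v ρ = mk⇔
  (λ h → to (rename-⊨ N ψ v ρ) ∘ h ∘ from (rename-⊨ N φ v ρ))
  (λ h → from (rename-⊨ N ψ v ρ) ∘ h ∘ to (rename-⊨ N φ v ρ))
rename-⊨ N (all′ φ) v ρ = mk⇔ (λ h a → to (at a) (h a)) (λ h a → from (at a) (h a))
  where
  at : ∀ a → N ⊨ rename (zero ∷ map suc v) φ at (a ∷ ρ) ⇔ N ⊨ φ at (a ∷ map (lookup ρ) v)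
  at a = subst (λ w → N ⊨ rename (zero ∷ map suc v) φ at (a ∷ ρ) ⇔ N ⊨ φ at (a ∷ w))
    (sym (map-∘ _ suc v)) (rename-⊨ N φ (zero ∷ map suc v) (a ∷ ρ))

-- Only the variables for parameters are substituted and the `n` type variables stay in place, so
-- the parameter tuple of a formula over `M` can be changed without touching x̄.
reindex : ∀ n → Vec (Fin s) r → Formula L (n + r) → Formula L (n + s)
reindex {s = s} n σ = rename (map (_↑ˡ s) (allFin n) ++ map (n ↑ʳ_) σ)

reindex-⊨ : (N : Structure L ℓ) (σ : Vec (Fin s) r) (φ : Formula L (n + r))
            (x̄ : Vec (Carrier N) n) (t : Vec (Carrier N) s) →
            N ⊨ reindex n σ φ at (x̄ ++ t) ⇔ N ⊨ φ at (x̄ ++ map (lookup t) σ)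
reindex-⊨ {s = s} {n = n} N σ φ x̄ t = subst
  (λ w → N ⊨ reindex n σ φ at (x̄ ++ t) ⇔ N ⊨ φ at w) variables (rename-⊨ N φ _ (x̄ ++ t))
  where
  variables : map (lookup (x̄ ++ t)) (map (_↑ˡ s) (allFin n) ++ map (n ↑ʳ_) σ) ≡
              x̄ ++ map (lookup t) σ
  variables = trans (map-++ _ (map (_↑ˡ s) (allFin n)) _) (cong₂ _++_
    (trans (sym (map-∘ _ _ (allFin n)))
      (trans (map-cong (lookup-++ˡ x̄ t) (allFin n)) (map-lookup-allFin x̄)))
    (trans (sym (map-∘ _ _ σ)) (map-cong (lookup-++ʳ x̄ t) σ)))

-- Quantifying away the type variables leaves a formula in the parameters alone, to which
-- elementarity of an extension of `M` applies.
closure : ∀ n → Formula L (n + r) → Formula L r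
closure zero    φ = φ
closure (suc n) φ = closure n (all′ φ)

closure-⊨ : (N : Structure L ℓ) → ∀ n (φ : Formula L (n + r)) (ρ : Vec (Carrier N) r) →
            N ⊨ closure n φ at ρ ⇔ (∀ x̄ → N ⊨ φ at (x̄ ++ ρ))
closure-⊨ N zero    φ ρ = mk⇔ (λ where h [] → h) (λ h → h [])
closure-⊨ N (suc n) φ ρ = mk⇔
  (λ where h (a ∷ x̄) → to (closure-⊨ N n (all′ φ) ρ) h x̄ a)
  (λ h → from (closure-⊨ N n (all′ φ) ρ) (λ x̄ a → h (a ∷ x̄)))

RealisesIn : {M : Structure L ℓ} (N : Structure L ℓ) → (Carrier M → Carrier N) →
             Vec (Carrier N) n → Pred (FormulaOver M n) ℓ
RealisesIn N h x̄ (φ [ m̄ ]) = N ⊨ φ at (x̄ ++ map h m̄)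

realisesIn-self : (M : Structure L ℓ) (x̄ : Vec (Carrier M) n) (φ : FormulaOver M n) →
                  RealisesIn M id x̄ φ ⇔ Realises M x̄ φ
realisesIn-self M x̄ (φ [ m̄ ]) = ≡⇒⇔ (cong (λ w → M ⊨ φ at (x̄ ++ w)) (map-id m̄))

_∧′_ : Formula L n → Formula L n → Formula L n
φ ∧′ ψ = ¬′ (φ ⇒′ ¬′ ψ)

module _ {M : Structure L ℓ} where

  infixr 5 _∧ₒ_

  _∧ₒ_ : FormulaOver M n → FormulaOver M n → FormulaOver M n
  _∧ₒ_ {n} (_[_] {r} φ m̄) (_[_] {s} ψ m̄′) =
    (reindex n (map (_↑ˡ s) (allFin r)) φ ∧′ reindex n (map (r ↑ʳ_) (allFin s)) ψ)
      [ m̄ ++ m̄′ ]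

  ⋀ : List (FormulaOver M n) → FormulaOver M n
  ⋀ []      = (¬′ ⊥′) [ [] ]
  ⋀ (φ ∷ Δ) = φ ∧ₒ ⋀ Δ

-- Isomorphisms and translations

map-fusion : ∀ {a} {A B C : Set a} {f : A → B} {g : B → C} {h : A → C} →
             (∀ x → g (f x) ≡ h x) → (xs : Vec A n) → map g (map f xs) ≡ map h xs
map-fusion eq xs = trans (sym (map-∘ _ _ xs)) (map-cong eq xs)

map-inverse : ∀ {a} {A B : Set a} {f : A → B} {g : B → A} →
              (∀ x → g (f x) ≡ x) → (xs : Vec A n) → map g (map f xs) ≡ xs
map-inverse eq xs = trans (map-fusion eq xs) (map-id xs)

map-select : ∀ {a} {A B : Set a} (f : A → B) (u : Vec A s) (σ : Vec (Fin s) r) →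
             map (lookup (map f u)) σ ≡ map f (map (lookup u) σ)
map-select f u σ = trans (map-cong (λ j → lookup-map j f u) σ) (map-∘ f (lookup u) σ)

vectorsOver : ∀ {a} {A : Set a} → List A → ∀ r → List (Vec A r)
vectorsOver xs zero    = [] ∷ []
vectorsOver xs (suc r) = List.cartesianProductWith _∷_ xs (vectorsOver xs r)

∈-vectorsOver : ∀ {a} {A : Set a} {xs : List A} (v : Vec A r) →
                (∀ i → lookup v i List∈.∈ xs) → v List∈.∈ vectorsOver xs r
∈-vectorsOver []      h = here refl
∈-vectorsOver (x ∷ v) h = ∈-cartesianProductWith⁺ _∷_ (h zero) (∈-vectorsOver v (h ∘ suc))

module _ {A B : Structure L ℓ} where

  ≅-embedding : A ≅ B → Embedding A B
  ≅-embedding f = record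
    { injection = mk↣ {to = F.to} λ e →
        trans (sym (F.strictlyInverseʳ _)) (trans (cong F.from e) (F.strictlyInverseʳ _))
    ; preserves = F.preserves
    }
    where module F = _≅_ f

  ≅-sym : A ≅ B → B ≅ A
  ≅-sym f = record
    { inverse   = mk↔ₛ′ F.from F.to F.strictlyInverseʳ F.strictlyInverseˡ
    ; preserves = λ R ys → subst (λ v → rel B R v ⇔ rel A R (map F.from ys))
        (map-inverse F.strictlyInverseˡ ys)
        (let e = F.preserves R (map F.from ys) in mk⇔ (from e) (to e))
    }
    where module F = _≅_ f

  enumeration-≅ : A ≅ B → Enumeration (Carrier A) → Enumeration (Carrier B)
  enumeration-≅ f ā = record
    { size       = size ā
    ; tuple      = map F.to (tuple ā)
    ; unique     = unique-map⁺ (Embedding.injective (≅-embedding f)) (unique ā)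
    ; exhaustive = λ y → subst (_∈ᵥ map F.to (tuple ā)) (F.strictlyInverseˡ y)
        (Vec∈.∈-map⁺ F.to (exhaustive ā (F.from y)))
    }
    where module F = _≅_ f

≅-refl : {A : Structure L ℓ} → A ≅ A
≅-refl {A = A} = record
  { inverse   = mk↔ₛ′ id id (λ _ → refl) (λ _ → refl)
  ; preserves = λ R xs → subst (λ v → rel A R xs ⇔ rel A R v) (sym (map-id xs)) (mk⇔ id id)
  }

≅-trans : {A B C : Structure L ℓ} → A ≅ B → B ≅ C → A ≅ C
≅-trans f g = record
  { inverse   = mk↔ₛ′ (G.to ∘ F.to) (F.from ∘ G.from)
      (λ z → trans (cong G.to (F.strictlyInverseˡ (G.from z))) (G.strictlyInverseˡ z))
      (λ x → trans (cong F.from (G.strictlyInverseʳ (F.to x))) (F.strictlyInverseʳ x))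
  ; preserves = Embedding.preserves (≅-embedding g ∘ₑ ≅-embedding f)
  }
  where module F = _≅_ f
        module G = _≅_ g

Range : {A M : Structure L ℓ} → Embedding A M → Pred (Carrier M) ℓ
Range f x = ∃[ a ] Embedding.to f a ≡ x

restrict : {M : Structure L ℓ} {P Q : Pred (Carrier M) ℓ} (f : Embedding M M) →
           .(∀ x → P x → Q (Embedding.to f x)) → Embedding (M ↾ P) (M ↾ Q)
restrict {M = M} {P} {Q} f P⇒Q = record
  { injection = mk↣ {to = f↾} λ e → value-injective (F.injective (cong value e))
  ; preserves = λ R xs → subst (λ v → rel M R (map value xs) ⇔ rel M R v)
      (trans (map-fusion (λ _ → refl) xs) (map-∘ value f↾ xs)) (F.preserves R (map value xs))
  }
  where
  module F = Embedding f

  f↾ : Carrier (M ↾ P) → Carrier (M ↾ Q)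
  f↾ (x , irr p) = F.to x , irr (P⇒Q x p)

module _ {M : Structure L ℓ} where

  translate-id : (φ : FormulaOver M n) → translate ≅-refl φ ≡ φ
  translate-id (φ [ m̄ ]) = cong (φ [_]) (map-id m̄)

  translate-∘ : (g h : Automorphism M) (φ : FormulaOver M n) →
                translate h (translate g φ) ≡ translate (≅-trans g h) φ
  translate-∘ g h (φ [ m̄ ]) = cong (φ [_]) (map-fusion (λ _ → refl) m̄)

  translate-inverseˡ : (g : Automorphism M) (φ : FormulaOver M n) →
                       translate (≅-sym g) (translate g φ) ≡ φ
  translate-inverseˡ g (φ [ m̄ ]) = cong (φ [_]) (map-inverse (_≅_.strictlyInverseʳ g) m̄)

  translate-inverseʳ : (g : Automorphism M) (φ : FormulaOver M n) →
                       translate g (translate (≅-sym g) φ) ≡ φ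
  translate-inverseʳ g (φ [ m̄ ]) = cong (φ [_]) (map-inverse (_≅_.strictlyInverseˡ g) m̄)

  -- `g · p` is an image, so membership yields only some `ψ` with the same translate; the inverse of
  -- `g` then identifies `ψ` with `φ`.
  translate-∈ : (g : Automorphism M) (p : S n M) (φ : FormulaOver M n) →
                φ ∈ formulae p ⇔ translate g φ ∈ formulae (g · p)
  translate-∈ g p φ = mk⇔ (λ h → φ , h , refl)
    (λ (ψ , h , e) → subst (_∈ formulae p)
      (trans (sym (translate-inverseˡ g ψ))
        (trans (cong (translate (≅-sym g)) e) (translate-inverseˡ g φ)))
      h)

  ∈-· : (g : Automorphism M) (p : S n M) (φ : FormulaOver M n) →
        φ ∈ formulae (g · p) ⇔ translate (≅-sym g) φ ∈ formulae p
  ∈-· g p φ = mk⇔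
    (λ h → from (translate-∈ g p (translate (≅-sym g) φ))
      (subst (_∈ formulae (g · p)) (sym (translate-inverseʳ g φ)) h))
    (λ h → subst (_∈ formulae (g · p)) (translate-inverseʳ g φ)
      (to (translate-∈ g p (translate (≅-sym g) φ)) h))

record Ultrafilter {ℓ : Level} (I : Set ℓ) : Set (lsuc ℓ) where
  field
    Large        : Pred (Pred I ℓ) ℓ
    upward       : ∀ {P Q} → (∀ {i} → P i → Q i) → Large P → Large Q
    intersection : ∀ {P Q} → Large P → Large Q → Large (λ i → P i × Q i)
    inhabited    : ∀ {P} → Large P → ∃[ i ] P i
    ultra        : ∀ P → Large P ⊎ Large (∁ P)

module Classical {ℓ : Level} (em : ExcludedMiddle ℓ) (ext : Extensionality ℓ 0ℓ) where

  -- Boolean-valued predicates make power sets stay at level ℓ, and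
  -- extensionality makes their equality extensional.
  decide : Set ℓ → Bool
  decide P = isYes (em {P})

  decide-true : {P : Set ℓ} → P → T (decide P)
  decide-true = fromWitness

  decide-sound : {P : Set ℓ} → T (decide P) → P
  decide-sound = toWitness

  bool-ext : ∀ {b c} → (T b → T c) → (T c → T b) → b ≡ c
  bool-ext {false} {false} _ _ = refl
  bool-ext {true}  {true}  _ _ = refl
  bool-ext {true}  {false} f _ = contradiction (f _) id
  bool-ext {false} {true}  _ g = contradiction (g _) id

  -- Ultrafilters by the Teichmüller–Tukey lemma

  module Tukey {X : Set ℓ} (C : Pred (List X) ℓ) (C-[] : C [])
               (C-anti : ∀ {xs ys} → xs List⊆.⊆ ys → C ys → C xs) where

    Subset : Set ℓ
    Subset = X → Bool

    infix 4 _⊑_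

    _⊑_ : Subset → Subset → Set ℓ
    A ⊑ B = ∀ {x} → T (A x) → T (B x)

    ⊑-antisym : ∀ {A B} → A ⊑ B → B ⊑ A → A ≡ B
    ⊑-antisym A⊑B B⊑A = ext λ _ → bool-ext A⊑B B⊑A

    Consistent : Pred Subset ℓ
    Consistent A = ∀ {xs} → All (T ∘ A) xs → C xs

    insert : X → Subset → Subset
    insert x A y = decide (T (A y) ⊎ y ≡ x)

    Extension : Pred Subset ℓ
    Extension A = ∃[ x ] ¬ T (A x) × Consistent (insert x A)

    next-by : ∀ A → Dec (Extension A) → Subset
    next-by A (yes (x , _)) = insert x A
    next-by A (no _)        = A

    next : Subset → Subset
    next A = next-by A em

    next-⊒ : ∀ {A} → A ⊑ next A
    next-⊒ {A} = by em
      where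
      by : (d : Dec (Extension A)) → A ⊑ next-by A d
      by (yes _) h = decide-true (inj₁ h)
      by (no _)  h = h

    ⋃ : (Subset → Bool) → Subset
    ⋃ F x = decide (∃[ A ] T (F A) × T (A x))

    ⋃-upper : ∀ F {A} → T (F A) → A ⊑ ⋃ F
    ⋃-upper F A∈F h = decide-true (_ , A∈F , h)

    ⋃-least : ∀ F {B} → (∀ {A} → T (F A) → A ⊑ B) → ⋃ F ⊑ B
    ⋃-least F bound h with decide-sound h
    ... | _ , A∈F , x∈A = bound A∈F x∈A

    -- As in the Bourbaki–Witt theorem, the stages are linearly ordered, so their union is a
    -- consistent fixed point of next, that is, a maximal consistent set.
    data Stage : Pred Subset ℓ where
      step  : ∀ {A} → Stage A → Stage (next A)
      union : ∀ F → (∀ {A} → T (F A) → Stage A) → Stage (⋃ F)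

    Extreme : Pred Subset ℓ
    Extreme B = ∀ {A} → Stage A → A ⊑ B → A ≡ B ⊎ next A ⊑ B

    -- Induction on `A`. At a union, either some member already lies above `next B`, or every member
    -- lies below `B` and so does the union.
    extreme-linear : ∀ {A B} → Extreme B → Stage A → A ⊑ B ⊎ next B ⊑ A
    extreme-linear extB (step stA) with extreme-linear extB stA
    ... | inj₂ B⁺⊑A = inj₂ (next-⊒ ∘ B⁺⊑A)
    ... | inj₁ A⊑B with extB stA A⊑B
    ...   | inj₁ refl = inj₂ id
    ...   | inj₂ A⁺⊑B = inj₁ A⁺⊑B
    extreme-linear {B = B} extB (union F sts)
      with em {∃[ A ] T (F A) × next B ⊑ A}
    ... | yes (_ , A∈F , B⁺⊑A) = inj₂ (⋃-upper F A∈F ∘ B⁺⊑A)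
    ... | no none = inj₁ (⋃-least F λ A∈F →
            [ id , (λ B⁺⊑A → contradiction (_ , A∈F , (λ {x} → B⁺⊑A {x})) none) ]′
              (extreme-linear extB (sts A∈F)))

    -- Induction on `B`. At a union above `A`, either every member lies below `A`, giving equality,
    -- or some member does not; that member is extreme, so it contains `next A`.
    stage-extreme : ∀ {B} → Stage B → Extreme B
    stage-extreme (step stB) stA A⊑B⁺ with extreme-linear (stage-extreme stB) stA
    ... | inj₂ B⁺⊑A = inj₁ (⊑-antisym A⊑B⁺ B⁺⊑A)
    ... | inj₁ A⊑B with stage-extreme stB stA A⊑B
    ...   | inj₁ refl = inj₂ id
    ...   | inj₂ A⁺⊑B = inj₂ (next-⊒ ∘ A⁺⊑B)
    stage-extreme (union F sts) {A} stA A⊑F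
      with em {∃[ B ] T (F B) × ¬ (B ⊑ A)}
    ... | no none = inj₁ (⊑-antisym A⊑F (⋃-least F bound))
      where
      bound : ∀ {B} → T (F B) → B ⊑ A
      bound {B} B∈F with em {B ⊑ A}
      ... | yes B⊑A = B⊑A
      ... | no B⋢A  = contradiction (B , B∈F , B⋢A) none
    ... | yes (B , B∈F , B⋢A) with extreme-linear (stage-extreme (sts B∈F)) stA
    ...   | inj₂ B⁺⊑A = contradiction (λ {x} h → B⁺⊑A {x} (next-⊒ h)) B⋢A
    ...   | inj₁ A⊑B with stage-extreme (sts B∈F) stA A⊑B
    ...     | inj₁ refl = contradiction (λ {x} h → h) B⋢A
    ...     | inj₂ A⁺⊑B = inj₂ (⋃-upper F B∈F ∘ A⁺⊑B)

    stage-linear : ∀ {A B} → Stage A → Stage B → A ⊑ B ⊎ B ⊑ A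
    stage-linear stA stB with extreme-linear (stage-extreme stB) stA
    ... | inj₁ A⊑B  = inj₁ A⊑B
    ... | inj₂ B⁺⊑A = inj₂ (B⁺⊑A ∘ next-⊒)

    -- In a chain the larger of two members absorbs the other, so finitely many points of the union
    -- lie in one member. The list is non-empty because `F` may have no member at all.
    ⋃-finite : ∀ F → (∀ {A} → T (F A) → Stage A) →
               ∀ {x xs} → All (T ∘ ⋃ F) (x ∷ xs) → ∃[ A ] T (F A) × All (T ∘ A) (x ∷ xs)
    ⋃-finite F sts (h ∷ []) with decide-sound h
    ... | A , A∈F , x∈A = A , A∈F , x∈A ∷ []
    ⋃-finite F sts (h ∷ hs@(_ ∷ _)) with decide-sound h | ⋃-finite F sts hs
    ... | A , A∈F , x∈A | B , B∈F , xs∈B with stage-linear (sts A∈F) (sts B∈F)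
    ...   | inj₁ A⊑B = B , B∈F , A⊑B x∈A ∷ xs∈B
    ...   | inj₂ B⊑A = A , A∈F , x∈A ∷ All.map B⊑A xs∈B

    stage-consistent : ∀ {A} → Stage A → Consistent A
    stage-consistent (step {A} stA) = by em
      where
      by : (d : Dec (Extension A)) → Consistent (next-by A d)
      by (yes (_ , _ , con)) = con
      by (no _)              = stage-consistent stA
    stage-consistent (union F sts) []           = C-[]
    stage-consistent (union F sts) hs@(_ ∷ _) with ⋃-finite F sts hs
    ... | _ , A∈F , xs∈A = stage-consistent (sts A∈F) xs∈A

    top : Subset
    top = ⋃ (λ A → decide (Stage A))

    -- The union of all stages is again a stage, hence contains its own successor. This
    -- impredicative closure replaces iteration along the ordinals.
    top-stage : Stage top
    top-stage = union _ decide-sound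

    top-consistent : Consistent top
    top-consistent = stage-consistent top-stage

    skip-second : ∀ {x y : X} {xs} → x ∷ xs List⊆.⊆ x ∷ y ∷ xs
    skip-second (here eq) = here eq
    skip-second (there m) = there (there m)

    insert-finite : ∀ {A x ys} → All (T ∘ insert x A) ys →
                    ∃[ xs ] All (T ∘ A) xs × ys List⊆.⊆ x ∷ xs
    insert-finite [] = [] , [] , λ ()
    insert-finite (h ∷ hs) with decide-sound h | insert-finite hs
    ... | inj₁ y∈A  | xs , xs∈A , sub = _ ∷ xs , y∈A ∷ xs∈A , λ where
      (here eq) → there (here eq)
      (there m) → skip-second (sub m)
    ... | inj₂ refl | xs , xs∈A , sub = xs , xs∈A , λ where
      (here eq) → here eq
      (there m) → sub m

    -- Were `x` outside, `insert x top` would be a consistent proper extension, so `next` would add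
    -- a point to `top`, not necessarily `x`; but `next top` is a stage and lies below `top`.
    top-maximal : ∀ {x} → (∀ {xs} → All (T ∘ top) xs → C (x ∷ xs)) → T (top x)
    top-maximal {x} con with em {Lift ℓ (T (top x))}
    ... | yes (lift x∈top) = x∈top
    ... | no x∉top         = by em next⊑top
      where
      con′ : Consistent (insert x top)
      con′ hs with insert-finite hs
      ... | _ , xs∈top , sub = C-anti sub (con xs∈top)

      next⊑top : next top ⊑ top
      next⊑top = ⋃-upper _ (decide-true (step top-stage))

      by : (d : Dec (Extension top)) → next-by top d ⊑ top → T (top x)
      by (no none) _ = contradiction (x , x∉top ∘ lift , λ {xs} → con′ {xs}) none
      by (yes (y , y∉top , _)) sub = contradiction (sub (decide-true (inj₂ refl))) y∉top

    top-extends : ∀ {x xs} → All (T ∘ top) xs →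
                  (∀ {ys} → C (xs List.++ ys) → C (x ∷ ys)) → T (top x)
    top-extends xs∈top f = top-maximal λ ys∈top → f (top-consistent (Allₚ.++⁺ xs∈top ys∈top))

  -- A maximal family whose finite subfamilies meet every tail {Δ : Δ₀ ⊆ Δ} contains all tails.
  module CofinalUltrafilter (K : Set ℓ) where

    Meets : Pred (List (List K → Bool)) ℓ
    Meets As = ∀ Δ₀ → ∃[ Δ ] Δ₀ List⊆.⊆ Δ × All (λ A → T (A Δ)) As

    meets-[] : Meets []
    meets-[] Δ₀ = Δ₀ , id , []

    meets-anti : ∀ {As Bs} → As List⊆.⊆ Bs → Meets Bs → Meets As
    meets-anti sub meets Δ₀ = let (Δ , Δ₀⊆Δ , hs) = meets Δ₀ in Δ , Δ₀⊆Δ , Allₚ.anti-mono sub hs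

    open Tukey Meets meets-[] meets-anti

    -- A set containing a finite intersection of members can be added without losing consistency,
    -- hence is a member by maximality. One and two sets give upward closure and intersections.
    top-closed : ∀ {As B} → All (T ∘ top) As →
                 (∀ {Δ} → All (λ A → T (A Δ)) As → T (B Δ)) → T (top B)
    top-closed {As} As∈top f = top-extends As∈top λ meets Δ₀ →
      let (Δ , sub , hs) = meets Δ₀
          As∋Δ , Bs∋Δ    = Allₚ.++⁻ As hs
      in Δ , sub , f As∋Δ ∷ Bs∋Δ

    Large : Pred (Pred (List K) ℓ) ℓ
    Large P = Lift ℓ (T (top (λ Δ → decide (P Δ))))

    tail-large : ∀ Δ₀ → Large (Δ₀ List⊆.⊆_)
    tail-large Δ₀ = lift (top-maximal λ As∈top Δ₁ →
      let (Δ , sub , hs) = top-consistent As∈top (Δ₀ List.++ Δ₁)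
      in Δ , sub ∘ ∈-++⁺ʳ Δ₀ , decide-true {Δ₀ List⊆.⊆ Δ} (sub ∘ ∈-++⁺ˡ) ∷ hs)

    ultrafilter : Ultrafilter (List K)
    ultrafilter = record
      { Large        = Large
      ; upward       = λ imp (lift h) → lift (top-closed (h ∷ []) λ where
          (p ∷ []) → decide-true (imp (decide-sound p)))
      ; intersection = λ (lift h) (lift h′) → lift (top-closed (h ∷ h′ ∷ []) λ where
          (p ∷ q ∷ []) → decide-true (decide-sound p , decide-sound q))
      ; inhabited    = λ (lift h) →
          let (Δ , _ , hs) = top-consistent (h ∷ []) [] in Δ , decide-sound (All.head hs)
      ; ultra        = ultra
      }
      where
      ultra : ∀ P → Large P ⊎ Large (∁ P)
      -- If `P` misses the intersection of some members with a tail, its complement contains that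
      -- intersection and is a member; otherwise `P` meets all such intersections and can be added.
      ultra P with em {∃[ As ] All (T ∘ top) As ×
                       ∃[ Δ₀ ] (∀ {Δ} → Δ₀ List⊆.⊆ Δ → All (λ A → T (A Δ)) As → ¬ P Δ)}
      ... | yes (As , As∈top , Δ₀ , avoids) =
        inj₂ (lift (top-closed (lower (tail-large Δ₀) ∷ As∈top) λ {Δ} hs →
          decide-true (avoids (decide-sound {Δ₀ List⊆.⊆ Δ} (All.head hs)) (All.tail hs))))
      ... | no none = inj₁ (lift (top-maximal meets))
        where
        meets : ∀ {As} → All (T ∘ top) As → Meets (_ ∷ As)
        meets {As} As∈top Δ₀
          with em {∃[ Δ ] Δ₀ List⊆.⊆ Δ × All (λ A → T (A Δ)) As × P Δ}
        ... | yes (Δ , sub , hs , p) = Δ , sub , decide-true p ∷ hs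
        ... | no ¬P = contradiction
          (As , As∈top , Δ₀ , λ {Δ} sub hs p → ¬P (Δ , (λ {x} → sub {x}) , hs , p)) none

  abstract

    -- Any given finite list is contained in almost every index. What holds at all indices
    -- containing certain finitely many elements of `K` therefore holds in the limit.
    cofinal-ultrafilter : (K : Set ℓ) →
      Σ[ U ∈ Ultrafilter (List K) ] (∀ Δ₀ → Ultrafilter.Large U (Δ₀ List⊆.⊆_))
    cofinal-ultrafilter K = CofinalUltrafilter.ultrafilter K , CofinalUltrafilter.tail-large K

  -- Types and ultrapowers

  stable : {P : Set ℓ} → ¬ ¬ P → P
  stable = decidable-stable em

  ∧′-⊨ : (N : Structure L ℓ) (φ ψ : Formula L n) (ρ : Vec (Carrier N) n) →
         N ⊨ φ ∧′ ψ at ρ ⇔ (N ⊨ φ at ρ × N ⊨ ψ at ρ)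
  ∧′-⊨ N φ ψ ρ = mk⇔
    (λ h → stable λ no → case h (λ a b → contradiction (a , b) no) of λ ())
    (λ (a , b) h → h a b)

  module _ {M N : Structure L ℓ} (h : Carrier M → Carrier N) (x̄ : Vec (Carrier N) n) where

    ∧ₒ-realisesIn : ∀ φ ψ → RealisesIn {M = M} N h x̄ (φ ∧ₒ ψ) ⇔
                            (RealisesIn {M = M} N h x̄ φ × RealisesIn {M = M} N h x̄ ψ)
    ∧ₒ-realisesIn (_[_] {r} φ m̄) (_[_] {s} ψ m̄′) = mk⇔
      (λ k → let (a , b) = to both k in to left a , to right b)
      (λ (a , b) → from both (from left a , from right b))
      where
      t : Vec (Carrier N) (r + s)
      t = map h (m̄ ++ m̄′)

      φ′ ψ′ : Formula L (n + (r + s))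
      φ′ = reindex n (map (_↑ˡ s) (allFin r)) φ
      ψ′ = reindex n (map (r ↑ʳ_) (allFin s)) ψ

      both : N ⊨ φ′ ∧′ ψ′ at (x̄ ++ t) ⇔ (N ⊨ φ′ at (x̄ ++ t) × N ⊨ ψ′ at (x̄ ++ t))
      both = ∧′-⊨ N φ′ ψ′ (x̄ ++ t)

      select : ∀ {k} (f : Fin k → Fin (r + s)) (v : Vec (Carrier M) k) →
               (∀ i → lookup (m̄ ++ m̄′) (f i) ≡ lookup v i) →
               map (lookup t) (map f (allFin k)) ≡ map h v
      select f v eq = trans (sym (map-∘ _ _ (allFin _))) (trans
        (map-cong (λ i → trans (lookup-map (f i) h (m̄ ++ m̄′)) (cong h (eq i))) (allFin _))
        (trans (map-∘ h (lookup v) (allFin _)) (cong (map h) (map-lookup-allFin v))))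

      left : N ⊨ φ′ at (x̄ ++ t) ⇔ N ⊨ φ at (x̄ ++ map h m̄)
      left = subst (λ w → N ⊨ φ′ at (x̄ ++ t) ⇔ N ⊨ φ at (x̄ ++ w))
        (select (_↑ˡ s) m̄ (lookup-++ˡ m̄ m̄′)) (reindex-⊨ N (map (_↑ˡ s) (allFin r)) φ x̄ t)

      right : N ⊨ ψ′ at (x̄ ++ t) ⇔ N ⊨ ψ at (x̄ ++ map h m̄′)
      right = subst (λ w → N ⊨ ψ′ at (x̄ ++ t) ⇔ N ⊨ ψ at (x̄ ++ w))
        (select (r ↑ʳ_) m̄′ (lookup-++ʳ m̄ m̄′)) (reindex-⊨ N (map (r ↑ʳ_) (allFin s)) ψ x̄ t)

    ⋀-realisesIn : ∀ Δ → RealisesIn {M = M} N h x̄ (⋀ Δ) ⇔ All (RealisesIn {M = M} N h x̄) Δ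
    ⋀-realisesIn []      = mk⇔ (λ _ → []) (λ _ → id)
    ⋀-realisesIn (φ ∷ Δ) = mk⇔
      (λ k → let (a , b) = to (∧ₒ-realisesIn φ (⋀ Δ)) k in a ∷ to (⋀-realisesIn Δ) b)
      (λ where (a ∷ as) → from (∧ₒ-realisesIn φ (⋀ Δ)) (a , from (⋀-realisesIn Δ) as))

  ⋀-realises : (M : Structure L ℓ) (x̄ : Vec (Carrier M) n) → ∀ Δ →
               Realises M x̄ (⋀ Δ) ⇔ All (Realises M x̄) Δ
  ⋀-realises M x̄ Δ = mk⇔
    (All.map (λ {φ} → to (realisesIn-self M x̄ φ)) ∘ to (⋀-realisesIn {M = M} id x̄ Δ) ∘
      from (realisesIn-self M x̄ (⋀ Δ)))
    (to (realisesIn-self M x̄ (⋀ Δ)) ∘ from (⋀-realisesIn {M = M} id x̄ Δ) ∘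
      All.map (λ {φ} → from (realisesIn-self M x̄ φ)))

  module _ {M N : Structure L ℓ} (M≼N : M ≼ N) where

    open _≼_ M≼N

    -- If no tuple of `M` realised the formula, the statement saying so about the parameters would
    -- pass to `N` by elementarity and exclude `ē`.
    reflect-realisation : (ψ : FormulaOver M n) (ē : Vec (Carrier N) n) →
                          RealisesIn N embed ē ψ → ∃[ x̄ ] Realises M x̄ ψ
    reflect-realisation {n} (φ [ m̄ ]) ē h = stable λ none →
      case to (closure-⊨ N n (¬′ φ) (map embed m̄))
             (to (elementary (closure n (¬′ φ)) m̄)
               (from (closure-⊨ M n (¬′ φ) m̄) λ x̄ h′ → contradiction (x̄ , h′) none))
             ē h of λ ()

    typeOf : Vec (Carrier N) n → S n M
    typeOf ē = record
      { formulae             = RealisesIn N embed ē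
      ; finitely-satisfiable = λ Δ hs →
          let (x̄ , h) = reflect-realisation (⋀ Δ) ē (from (⋀-realisesIn embed ē Δ) hs)
          in x̄ , to (⋀-realises M x̄ Δ) h
      ; complete             = complete-at
      }
      where
      complete-at : ∀ φ → RealisesIn N embed ē φ ⊎ RealisesIn N embed ē (notOver φ)
      complete-at (φ [ m̄ ]) with em {N ⊨ φ at (ē ++ map embed m̄)}
      ... | yes h = inj₁ h
      ... | no ¬h = inj₂ λ h → contradiction h ¬h

  notOver-realises : (M : Structure L ℓ) (x̄ : Vec (Carrier M) n) (φ : FormulaOver M n) →
                     Realises M x̄ (notOver φ) → ¬ Realises M x̄ φ
  notOver-realises M x̄ (φ [ m̄ ]) h h′ = case h h′ of λ ()

  module _ {M : Structure L ℓ} (p : S n M) where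

    -- Otherwise the type contains the negation of `φ`, and finite satisfiability realises it in `M`
    -- together with `Δ`.
    entails : ∀ {Δ} φ → All (formulae p) Δ →
              (∀ x̄ → All (Realises M x̄) Δ → Realises M x̄ φ) → φ ∈ formulae p
    entails {Δ} φ hs imp with complete p φ
    ... | inj₁ φ∈p  = φ∈p
    ... | inj₂ ¬φ∈p with finitely-satisfiable p (notOver φ ∷ Δ) (¬φ∈p ∷ hs)
    ...   | x̄ , ¬φ ∷ rs = contradiction (imp x̄ rs) (notOver-realises M x̄ φ ¬φ)

    notOver-∉ : ∀ φ → notOver φ ∈ formulae p → ¬ φ ∈ formulae p
    notOver-∉ φ ¬φ∈p φ∈p with finitely-satisfiable p (notOver φ ∷ φ ∷ []) (¬φ∈p ∷ φ∈p ∷ [])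
    ... | x̄ , ¬r ∷ r ∷ [] = notOver-realises M x̄ φ ¬r r

    ⋀-∈ : ∀ Δ → ⋀ Δ ∈ formulae p ⇔ All (formulae p) Δ
    ⋀-∈ Δ = mk⇔
      (λ h → All.tabulate λ {φ} φ∈Δ → entails φ (h ∷ []) λ where
        x̄ (r ∷ []) → All.lookup (to (⋀-realises M x̄ Δ) r) φ∈Δ)
      (λ hs → entails (⋀ Δ) hs λ x̄ → from (⋀-realises M x̄ Δ))

  -- Ultralimits of types

  module Limit {I : Set ℓ} (U : Ultrafilter I) where

    open Ultrafilter U

    everywhere : ∀ {P : Pred I ℓ} → (∀ i → P i) → Large P
    everywhere {P} h with ultra P
    ... | inj₁ large = large
    ... | inj₂ large = let (i , ¬p) = inhabited large in contradiction (h i) ¬p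

    large-∁ : ∀ {P : Pred I ℓ} → Large (∁ P) → ¬ Large P
    large-∁ c l = let (_ , ¬p , p) = inhabited (intersection c l) in ¬p p

    large-All : ∀ {A : Set ℓ} (P : I → Pred A ℓ) {xs} →
                All (λ x → Large (λ i → P i x)) xs → Large (λ i → All (P i) xs)
    large-All P []       = everywhere λ _ → []
    large-All P (h ∷ hs) = upward (λ (p , ps) → p ∷ ps) (intersection h (large-All P hs))

    -- Finitely many formulae of the limit lie in a common `p i`, which supplies the realising
    -- tuple; completeness comes from `ultra`.
    limit : {M : Structure L ℓ} → (I → S n M) → S n M
    limit p = record
      { formulae             = λ φ → Large λ i → φ ∈ formulae (p i)
      ; finitely-satisfiable = λ Δ hs →
          let (i , h) = inhabited (large-All (λ i → formulae (p i)) hs)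
          in finitely-satisfiable (p i) Δ h
      ; complete             = λ φ → case ultra (λ i → φ ∈ formulae (p i)) of λ where
          (inj₁ h) → inj₁ h
          (inj₂ h) → inj₂ (upward (λ {i} φ∉p → case complete (p i) φ of λ where
            (inj₁ φ∈p)  → contradiction φ∈p φ∉p
            (inj₂ ¬φ∈p) → ¬φ∈p) h)
      }

  -- Quotients, ultrapowers and realisations of types

  record Quotient {A : Set ℓ} (_~_ : A → A → Set ℓ) : Set (lsuc ℓ) where
    field
      Class   : Set ℓ
      π       : A → Class
      rep     : Class → A
      π-~     : ∀ x → rep (π x) ~ x
      rep-~   : ∀ {q q′} → rep q ~ rep q′ → q ≡ q′

  abstract

    -- A class is represented by a canonical element, chosen from its characteristic function.
    -- Equivalent points have equal characteristic functions, so the choices agree, and the quotient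
    -- stays at level `ℓ`.
    quotient : {A : Set ℓ} {_~_ : A → A → Set ℓ} → IsEquivalence _~_ → Quotient _~_
    quotient {A} {_~_} ~-equiv = record
      { Class   = [ x ∈ A ∣ canon x ≡ x ]
      ; π       = λ x → canon x , irr (canon-cong (~.sym (canon-~ x)))
      ; rep     = value
      ; π-~     = λ x → ~.sym (canon-~ x)
      ; rep-~   = λ {q} {q′} h →
          value-injective (trans (sym (canonical q)) (trans (canon-cong h) (canonical q′)))
      }
      where
      module ~ = IsEquivalence ~-equiv

      class : A → A → Bool
      class x y = decide (x ~ y)

      class-cong : ∀ {x y} → x ~ y → class x ≡ class y
      class-cong x~y = ext λ _ → bool-ext
        (λ h → decide-true (~.trans (~.sym x~y) (decide-sound h)))
        (λ h → decide-true (~.trans x~y (decide-sound h)))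

      -- The irrelevance of the second argument makes the choice depend on the
      -- class alone.
      pick : (c : A → Bool) → .(∃[ x ] T (c x)) → ∃[ x ] T (c x)
      pick c w = recompute em w

      canon : A → A
      canon x = proj₁ (pick (class x) (x , decide-true ~.refl))

      canon-~ : ∀ x → x ~ canon x
      canon-~ x = decide-sound (proj₂ (pick (class x) (x , decide-true ~.refl)))

      pick-cong : ∀ {c d : A → Bool} → c ≡ d → .(v : ∃[ x ] T (c x)) → .(w : ∃[ x ] T (d x)) →
                  proj₁ (pick c v) ≡ proj₁ (pick d w)
      pick-cong refl _ _ = refl

      canon-cong : ∀ {x y} → x ~ y → canon x ≡ canon y
      canon-cong x~y = pick-cong (class-cong x~y) (_ , decide-true ~.refl) (_ , decide-true ~.refl)

      canonical : ∀ (q : [ x ∈ A ∣ canon x ≡ x ]) → canon (value q) ≡ value q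
      canonical (x , irr e) = recompute em e

  module Ultrapower (M : Structure L ℓ) {I : Set ℓ} (U : Ultrafilter I) where

    open Ultrafilter U
    open Limit U

    _~_ : (f g : I → Carrier M) → Set ℓ
    f ~ g = Large λ i → f i ≡ g i

    ~-isEquivalence : IsEquivalence _~_
    ~-isEquivalence = record
      { refl  = everywhere λ _ → refl
      ; sym   = upward sym
      ; trans = λ h k → upward (λ (a , b) → trans a b) (intersection h k)
      }

    open Quotient (quotient ~-isEquivalence) public

    at-index : I → ∀ {k} → Vec Class k → Vec (Carrier M) k
    at-index i = map λ q → rep q i

    -- Formulae interpret equality as `≡`, which calls for a genuine quotient. Relations are read on
    -- the chosen representatives, so well-definedness is automatic.
    M^I/U : Structure L ℓ
    M^I/U = record
      { Carrier = Class
      ; rel     = λ R qs → Large λ i → rel M R (at-index i qs)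
      }

    large-⇒ : ∀ {P Q : Pred I ℓ} → Large (λ i → P i → Q i) ⇔ (Large P → Large Q)
    large-⇒ {P} {Q} = mk⇔
      (λ h k → upward (λ (f , x) → f x) (intersection h k))
      (λ h → case ultra P of λ where
        (inj₁ k) → upward (λ y _ → y) (h k)
        (inj₂ k) → upward (λ ¬x x → contradiction x ¬x) k)

    Łoś : ∀ (φ : Formula L n) ρ → M^I/U ⊨ φ at ρ ⇔ Large λ i → M ⊨ φ at at-index i ρ
    Łoś (rel′ R xs) ρ = mk⇔
      (upward λ {i} → subst (rel M R) (eq i)) (upward λ {i} → subst (rel M R) (sym (eq i)))
      where
      eq : ∀ i → at-index i (map (lookup ρ) xs) ≡ map (lookup (at-index i ρ)) xs
      eq i = trans (sym (map-∘ _ _ xs)) (map-cong (λ x → sym (lookup-map x _ ρ)) xs)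
    Łoś (eq′ x y) ρ = mk⇔
      (λ e → everywhere λ i → trans (lookup-map x _ ρ)
        (trans (cong (λ q → rep q i) e) (sym (lookup-map y _ ρ))))
      (λ h → rep-~ (upward (λ e → trans (sym (lookup-map x _ ρ)) (trans e (lookup-map y _ ρ))) h))
    Łoś ⊥′ ρ = mk⇔ (λ ()) (λ h → proj₂ (inhabited h))
    Łoś (φ ⇒′ ψ) ρ = mk⇔
      (λ h → from large-⇒ (to (Łoś ψ ρ) ∘ h ∘ from (Łoś φ ρ)))
      (λ h → from (Łoś ψ ρ) ∘ to large-⇒ h ∘ to (Łoś φ ρ))
    Łoś (all′ φ) ρ = mk⇔ all-large
      (λ h q → from (Łoś φ (q ∷ ρ)) (upward (λ {i} k → k (rep q i)) h))
      where
      Counterexample : Pred I ℓ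
      Counterexample i = ∃[ a ] ¬ M ⊨ φ at (a ∷ at-index i ρ)

      all-large : (∀ q → M^I/U ⊨ φ at (q ∷ ρ)) → Large λ i → ∀ a → M ⊨ φ at (a ∷ at-index i ρ)
      -- If counterexamples existed almost everywhere, choosing one at each index would give an
      -- element of the ultrapower refuting `φ`.
      all-large h with ultra Counterexample
      ... | inj₂ none = upward (λ c a → stable λ k → c (a , k)) none
      ... | inj₁ some = contradiction
        (to (Łoś φ (π f ∷ ρ)) (h (π f)))
        (large-∁ (upward (λ {i} (e , c) →
          subst (λ a → ¬ M ⊨ φ at (a ∷ at-index i ρ)) (sym e) (f-counterexample i c))
          (intersection (π-~ f) some)))
        where
        f-by : ∀ i → Dec (Counterexample i) → Carrier M
        f-by i (yes (a , _)) = a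
        -- Indices without a counterexample form a negligible set, so any value serves there. It is
        -- borrowed from an index that has one, which also shows that `M` has an element.
        f-by i (no _)        = proj₁ (proj₂ (inhabited some))

        f : I → Carrier M
        f i = f-by i em

        f-counterexample : ∀ i → Counterexample i → ¬ M ⊨ φ at (f i ∷ at-index i ρ)
        f-counterexample i c = by em
          where
          by : (d : Dec (Counterexample i)) → ¬ M ⊨ φ at (f-by i d ∷ at-index i ρ)
          by (yes (_ , ¬φ)) = ¬φ
          by (no none)      = contradiction c none

    at-index-π : ∀ {k} (fs : Vec (I → Carrier M) k) →
                 Large λ i → at-index i (map π fs) ≡ map (λ f → f i) fs
    at-index-π []       = everywhere λ _ → refl
    at-index-π (f ∷ fs) =
      upward (λ (e , es) → cong₂ _∷_ e es) (intersection (π-~ f) (at-index-π fs))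

    -- `rep (π f)` agrees with `f` only almost everywhere; for finitely many coordinates the
    -- exceptional sets can be discarded together, so `Łoś` may be read on the given functions.
    Łoś-π : ∀ (φ : Formula L n) (fs : Vec (I → Carrier M) n) →
            M^I/U ⊨ φ at map π fs ⇔ Large λ i → M ⊨ φ at map (λ f → f i) fs
    Łoś-π φ fs = mk⇔
      (λ h → upward (λ (e , k) → subst (M ⊨ φ at_) e k)
        (intersection (at-index-π fs) (to (Łoś φ _) h)))
      (λ h → from (Łoś φ _) (upward (λ (e , k) → subst (M ⊨ φ at_) (sym e) k)
        (intersection (at-index-π fs) h)))

    diagonal : Carrier M → Class
    diagonal a = π λ _ → a

    map-const : ∀ {k} (i : I) (v : Vec (Carrier M) k) → map (λ f → f i) (map (λ a _ → a) v) ≡ v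
    map-const i v = trans (sym (map-∘ _ _ v)) (map-id v)

    M≼M^I/U : M ≼ M^I/U
    M≼M^I/U = record
      { embed      = diagonal
      ; elementary = λ φ ρ → subst (λ w → M ⊨ φ at ρ ⇔ M^I/U ⊨ φ at w) (sym (map-∘ _ _ ρ)) (mk⇔
          (λ h → from (Łoś-π φ _) (everywhere λ i →
            subst (M ⊨ φ at_) (sym (map-const i ρ)) h))
          (λ h → let (i , k) = inhabited (to (Łoś-π φ _) h) in
            subst (M ⊨ φ at_) (map-const i ρ) k))
      }

    coordinates : (I → Vec (Carrier M) n) → Vec (I → Carrier M) n
    coordinates x̄ = tabulate λ j i → lookup (x̄ i) j

    classes : (I → Vec (Carrier M) n) → Vec Class n
    classes x̄ = map π (coordinates x̄)

    realisesIn-ultrapower : (x̄ : I → Vec (Carrier M) n) (ψ : FormulaOver M n) →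
      Large (λ i → Realises M (x̄ i) ψ) →
      RealisesIn M^I/U diagonal (classes x̄) ψ
    realisesIn-ultrapower x̄ (φ [ m̄ ]) h =
      subst (M^I/U ⊨ φ at_) eq
        (from (Łoś-π φ fs) (upward (λ {i} → subst (M ⊨ φ at_) (sym (eq-at i))) h))
      where
      fs = coordinates x̄ ++ map (λ a _ → a) m̄

      eq : map π fs ≡ classes x̄ ++ map diagonal m̄
      eq = trans (map-++ π (coordinates x̄) _) (cong (classes x̄ ++_) (sym (map-∘ π _ m̄)))

      eq-at : ∀ i → map (λ f → f i) fs ≡ x̄ i ++ m̄
      eq-at i = trans (map-++ _ (coordinates x̄) _) (cong₂ _++_
        (trans (sym (tabulate-∘ _ _)) (tabulate∘lookup (x̄ i))) (map-const i m̄))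

  record Realisation {M : Structure L ℓ} (p : S n M) : Set (lsuc ℓ) where
    field
      N         : Structure L ℓ
      extension : M ≼ N
      ē         : Vec (Carrier N) n
      realises  : ∀ φ → φ ∈ formulae p ⇔ RealisesIn N (_≼_.embed extension) ē φ

  -- The indices are the finite parts of `p`, each solved in `M`. The class of the solutions
  -- realises every formula of `p`, as almost every part contains it; completeness of `p` gives the
  -- converse.
  realisation : {M : Structure L ℓ} (p : S n M) → Realisation p
  realisation {M = M} p = record
    { N         = M^I/U
    ; extension = M≼M^I/U
    ; ē         = ē
    ; realises  = λ φ → mk⇔ (realised φ) (converse φ)
    }
    where
    K : Set ℓ
    K = ∃[ φ ] φ ∈ formulae p

    U : Ultrafilter (List K)
    U = proj₁ (cofinal-ultrafilter K)

    open Ultrafilter U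
    open Ultrapower M U

    solution : (Δ : List K) → ∃[ x̄ ] All (Realises M x̄) (List.map proj₁ Δ)
    solution Δ = finitely-satisfiable p (List.map proj₁ Δ) (Allₚ.map⁺ (All.universal proj₂ Δ))

    ē = classes (proj₁ ∘ solution)

    realised : ∀ φ → φ ∈ formulae p → RealisesIn M^I/U diagonal ē φ
    realised φ φ∈p = realisesIn-ultrapower (proj₁ ∘ solution) φ
      (upward (λ {Δ} sub → All.lookup (proj₂ (solution Δ)) (∈-map⁺ proj₁ (sub (here refl))))
        (proj₂ (cofinal-ultrafilter K) ((φ , φ∈p) ∷ [])))

    converse : ∀ φ → RealisesIn M^I/U diagonal ē φ → φ ∈ formulae p
    converse φ@(_ [ _ ]) h with complete p φ
    ... | inj₁ φ∈p  = φ∈p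
    ... | inj₂ ¬φ∈p = case realised (notOver φ) ¬φ∈p h of λ ()

  -- Homogeneity for embeddings and enumerations of finite subsets

  range-≅ : {A M : Structure L ℓ} (f : Embedding A M) → A ≅ (M ↾ Range f)
  range-≅ {A = A} {M} f = record
    { inverse   = mk↔ₛ′ (λ a → F.to a , irr (a , refl))
        (proj₁ ∘ preimage) (value-injective ∘ proj₂ ∘ preimage)
        (λ a → F.injective (proj₂ (preimage (F.to a , irr (a , refl)))))
    ; preserves = λ R xs → subst (λ v → rel A R xs ⇔ rel M R v) (map-∘ value _ xs)
        (F.preserves R xs)
    }
    where
    module F = Embedding f

    preimage : (y : Carrier (M ↾ Range f)) → ∃[ a ] F.to a ≡ value y
    preimage (x , irr h) = recompute em h

  homogeneous : {A M : Structure L ℓ} → Ultrahomogeneous M → Finite A → (f h : Embedding A M) →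
                Σ[ g ∈ Automorphism M ] (∀ a → _≅_.to g (Embedding.to f a) ≡ Embedding.to h a)
  homogeneous hom fin f h =
    let (g , extends) = hom (Range f) (Range h) (enumeration-≅ (range-≅ f) fin)
          (enumeration-≅ (range-≅ h) fin) (≅-trans (≅-sym (range-≅ f)) (range-≅ h))
    in g , λ a → trans (extends (_≅_.to (range-≅ f) a))
         (cong (Embedding.to h) (_≅_.strictlyInverseʳ (range-≅ f) a))

  distinct : {A : Set ℓ} (v : Vec A r) →
             ∃[ s ] Σ[ u ∈ Vec A s ] Unique u × (∀ {x} → x ∈ᵥ v → x ∈ᵥ u)
  distinct [] = zero , [] , AllPairs.[] , id
  distinct (x ∷ v) with distinct v
  ... | s , u , u! , sub with em {x ∈ᵥ u}
  ...   | yes x∈u = s , u , u! , λ where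
    (VecAny.here refl) → x∈u
    (VecAny.there m)   → sub m
  ...   | no x∉u = suc s , x ∷ u , VecAllₚ.lookup⁻ x≢ AllPairs.∷ u! , λ where
      (VecAny.here refl) → VecAny.here refl
      (VecAny.there m)   → VecAny.there (sub m)
    where
    x≢ : ∀ i → ¬ x ≡ lookup u i
    x≢ i x≡ = x∉u (subst (_∈ᵥ u) (sym x≡) (Vec∈.∈-lookup i u))

  enumeration : {A : Set ℓ} (v : Vec A r) → (∀ x → x ∈ᵥ v) → Enumeration A
  enumeration v all =
    let (s , u , u! , sub) = distinct v
    in record { size = s ; tuple = u ; unique = u! ; exhaustive = λ x → sub (all x) }

  module _ {A : Set ℓ} (v : Vec A r) where

    member : Fin r → [ x ∈ A ∣ x ∈ᵥ v ]
    member i = lookup v i , irr (Vec∈.∈-lookup i v)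

    ∈-members : ∀ x → x ∈ᵥ tabulate member
    ∈-members (x , irr h) = subst (_∈ᵥ tabulate member)
      (value-injective (sym (VecAnyₚ.lookup-index (recompute em h))))
      (Vec∈.∈-tabulate⁺ member (VecAny.index (recompute em h)))

    members : Enumeration [ x ∈ A ∣ x ∈ᵥ v ]
    members = enumeration (tabulate member) ∈-members

    -- The parameters of a formula may repeat, while copies are coloured along enumerations without
    -- repetition. These indices read the original tuple off the enumeration of its entries.
    positions : Vec (Fin (size members)) r
    positions = tabulate λ i → VecAny.index (exhaustive members (member i))

    positions-spec : map (lookup (map value (tuple members))) positions ≡ v
    positions-spec = trans (sym (tabulate-∘ _ _)) (trans (tabulate-cong at) (tabulate∘lookup v))
      where
      at : ∀ i → lookup (map value (tuple members))
                   (VecAny.index (exhaustive members (member i))) ≡ lookup v i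
      at i = trans (lookup-map _ value (tuple members))
        (cong value (sym (VecAnyₚ.lookup-index (exhaustive members (member i)))))

  -- Fixed points and monochromatic copies

  -- Whichever of `φ` and its negation lies in `p`. A type containing it agrees with `p` on `φ`, so
  -- agreement on a finite list is a single conjunction, that is, a basic open condition.
  decided : {M : Structure L ℓ} → S n M → FormulaOver M n → FormulaOver M n
  decided p φ with complete p φ
  ... | inj₁ _ = φ
  ... | inj₂ _ = notOver φ

  decided-∈ : {M : Structure L ℓ} (p : S n M) (φ : FormulaOver M n) → decided p φ ∈ formulae p
  decided-∈ p φ with complete p φ
  ... | inj₁ h = h
  ... | inj₂ h = h

  decided-agree : {M : Structure L ℓ} (p q : S n M) (φ : FormulaOver M n) →
                  decided p φ ∈ formulae q → φ ∈ formulae p ⇔ φ ∈ formulae q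
  decided-agree p q φ h with complete p φ
  ... | inj₁ φ∈p  = mk⇔ (λ _ → h) (λ _ → φ∈p)
  ... | inj₂ ¬φ∈p = mk⇔ (λ φ∈p → contradiction φ∈p (notOver-∉ p φ ¬φ∈p))
                        (λ φ∈q → contradiction φ∈q (notOver-∉ q φ h))

  module _ {M : Structure L ℓ} where

    OrbitClosure : S n M → Pred (S n M) ℓ
    OrbitClosure p q = ∀ φ → φ ∈ formulae q → ∃[ g ] φ ∈ formulae (g · p)

    orbitClosure-isSubflow : (p : S n M) → IsSubflow (OrbitClosure p)
    orbitClosure-isSubflow p = record
      { nonempty  = p , λ φ h → ≅-refl , φ , h , translate-id φ
      ; closed    = λ q q∉ →
          let (φ , φ∈q , none) = stable {∃[ φ ] φ ∈ formulae q × ¬ (∃[ g ] φ ∈ formulae (g · p))}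
                λ no → q∉ λ φ φ∈q → stable λ none → no (φ , φ∈q , none)
          in φ , φ∈q , λ φ∈q′ q′∈ → none (q′∈ φ φ∈q′)
      ; invariant = λ where
          h q q∈ _ (φ , φ∈q , refl) → let (g , ψ , ψ∈p , e) = q∈ φ φ∈q in
            ≅-trans g h , ψ , ψ∈p , trans (sym (translate-∘ g h ψ)) (cong (translate h) e)
      }

    orbitClosure-agree : (p q : S n M) → q ∈ OrbitClosure p → (Δ : List (FormulaOver M n)) →
      ∃[ g ] (∀ {φ} → φ List∈.∈ Δ → φ ∈ formulae q ⇔ φ ∈ formulae (g · p))
    orbitClosure-agree p q q∈ Δ =
      let (g , h) = q∈ (⋀ (List.map (decided q) Δ))
            (from (⋀-∈ q _) (Allₚ.map⁺ (All.universal (decided-∈ q) Δ)))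
      in g , λ {φ} φ∈Δ → decided-agree q (g · p) φ
           (All.lookup (to (⋀-∈ (g · p) (List.map (decided q) Δ)) h) (∈-map⁺ (decided q) φ∈Δ))

    closed-adherent : {X : Pred (S n M) ℓ} → Closed X → (q : S n M) →
                      (∀ φ → φ ∈ formulae q → Σ[ p ∈ S n M ] p ∈ X × φ ∈ formulae p) → q ∈ X
    closed-adherent closed q adherent = stable λ q∉X →
      let (φ , φ∈q , avoids) = closed q q∉X
          (p , p∈X , φ∈p)    = adherent φ φ∈q
      in avoids {p} φ∈p p∈X

    limit-closed : {X : Pred (S n M) ℓ} → Closed X → {I : Set ℓ} (U : Ultrafilter I)
                   (p : I → S n M) → (∀ i → p i ∈ X) → Limit.limit U p ∈ X
    limit-closed closed U p p∈X = closed-adherent closed (Limit.limit U p) λ φ large →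
      let (i , φ∈p) = Ultrafilter.inhabited U large in p i , p∈X i , φ∈p

    type₀ : (p : S 0 M) (φ : FormulaOver M 0) → φ ∈ formulae p ⇔ Realises M [] φ
    type₀ p φ = mk⇔
      (λ h → case finitely-satisfiable p (φ ∷ []) (h ∷ []) of λ where ([] , r ∷ []) → r)
      (λ r → entails p {[]} φ [] λ where [] _ → r)

    -- `FPT` starts at `n = 1`, but the defining tuple of a colouring may be empty. A 0-type
    -- consists of the formulae over `M` true in `M`, so it is already fixed.
    fpt-orbitClosure : FPT M → ∀ n (p : S n M) → ∃[ q ] q ∈ OrbitClosure p × q ∈ Fixed
    fpt-orbitClosure fpt zero p =
      p , proj₂ (IsSubflow.nonempty (orbitClosure-isSubflow p)) , λ g →
        (λ {φ} h → from (type₀ p φ) (to (type₀ (g · p) φ) h)) ,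
        (λ {φ} h → from (type₀ (g · p) φ) (to (type₀ p φ) h))
    fpt-orbitClosure fpt (suc n) p =
      fpt (suc n) (s≤s z≤n) (OrbitClosure p) (orbitClosure-isSubflow p)

  -- From fixed points to monochromatic copies

  module _ {M : Structure L ℓ} (hom : Ultrahomogeneous M) where

    fpt⇒ramsey : FPT M → EDRamsey M
    fpt⇒ramsey fpt A _ ā k _ B (b̄ , e) χ definable = P , ≅-sym (range-≅ e′) , monochromatic
      where
      open ExternallyDefinable definable renaming (m to m′)
      open _≼_ extension using (embed)

      p : S m′ M
      p = typeOf extension ē

      fixedPoint : ∃[ q ] q ∈ OrbitClosure p × q ∈ Fixed
      fixedPoint = fpt-orbitClosure fpt m′ p

      q : S m′ M
      q = proj₁ fixedPoint

      Es : List (Carrier M)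
      Es = toList (map (Embedding.to e) (tuple b̄))

      instances : List (FormulaOver M m′)
      instances = List.cartesianProductWith (λ i t → φ i [ t ])
        (List.allFin k) (vectorsOver Es (size ā))

      agreement : ∃[ g ] (∀ {ψ} → ψ List∈.∈ instances → ψ ∈ formulae q ⇔ ψ ∈ formulae (g · p))
      agreement = orbitClosure-agree p q (proj₁ (proj₂ fixedPoint)) instances

      g : Automorphism M
      g = proj₁ agreement

      module G = _≅_ g

      -- Agreement relates `q` to `g · p` on the copy given by `e`. The colours are read off `p`
      -- itself, so the copy has to be pulled back by `g`.
      e′ : Embedding B M
      e′ = ≅-embedding (≅-sym g) ∘ₑ e

      P : Pred (Carrier M) ℓ
      P = Range e′

      g-∈ : (x : Carrier (M ↾ P)) → G.to (value x) List∈.∈ Es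
      g-∈ (x , irr h) = let (b , g⁻¹eb≡x) = recompute em h in
        subst (List∈._∈ Es) (trans (sym (G.strictlyInverseˡ _)) (cong G.to g⁻¹eb≡x))
          (Vec∈.∈-toList⁺ (Vec∈.∈-map⁺ (Embedding.to e) (exhaustive b̄ b)))

      push : Copies (M ↾ P) A ā → Copies M A ā
      push = pushCopy (inclusion M P) A ā

      copy-tuple : Copies (M ↾ P) A ā → Vec (Carrier M) (size ā)
      copy-tuple c = proj₁ (push c)

      agrees : ∀ c i → φ i [ map G.to (copy-tuple c) ] ∈ formulae q ⇔
                       φ i [ map G.to (copy-tuple c) ] ∈ formulae (g · p)
      agrees c i = proj₂ agreement (∈-cartesianProductWith⁺ (λ i t → φ i [ t ]) (∈-allFin i)
        (∈-vectorsOver _ λ j → subst (List∈._∈ Es)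
          (sym (trans (lookup-map j G.to (copy-tuple c))
            (cong G.to (lookup-map j value (proj₁ c)))))
          (g-∈ (lookup (proj₁ c) j))))

      moved : ∀ c d → Σ[ a ∈ Automorphism M ]
              map (_≅_.to a) (map G.to (copy-tuple c)) ≡ map G.to (copy-tuple d)
      moved c d =
        let (_ , f , ec) = push c
            (_ , h , ed) = push d
            (a , af≡h)   = homogeneous hom ā (≅-embedding g ∘ₑ f) (≅-embedding g ∘ₑ h)
        in a , (begin
          map (_≅_.to a) (map G.to (copy-tuple c))
            ≡⟨ cong (map (_≅_.to a) ∘ map G.to) ec ⟨
          map (_≅_.to a) (map G.to (map (Embedding.to f) (tuple ā)))
            ≡⟨ cong (map (_≅_.to a)) (map-fusion (λ _ → refl) (tuple ā)) ⟩
          map (_≅_.to a) (map (G.to ∘ Embedding.to f) (tuple ā))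
            ≡⟨ map-fusion af≡h (tuple ā) ⟩
          map (G.to ∘ Embedding.to h) (tuple ā)
            ≡⟨ map-fusion (λ _ → refl) (tuple ā) ⟨
          map G.to (map (Embedding.to h) (tuple ā))
            ≡⟨ cong (map G.to) ed ⟩
          map G.to (copy-tuple d) ∎)
        where open ≡-Reasoning

      -- The formula for the colour of `c` passes from `p` to `g · p`, to `q` by agreement, along
      -- the orbit to the tuple of `d` because `q` is fixed, and back to `p`.
      monochromatic : ∀ c d → χ (push c) ≡ χ (push d)
      monochromatic c d = sym (from (defines (push d) i) φd∈p)
        where
        i : Fin k
        i = χ (push c)

        a : Automorphism M
        a = proj₁ (moved c d)

        gc gd : FormulaOver M m′
        gc = φ i [ map G.to (copy-tuple c) ]
        gd = φ i [ map G.to (copy-tuple d) ]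

        gc∈q : gc ∈ formulae q
        gc∈q = from (agrees c i)
          (to (translate-∈ g p (φ i [ copy-tuple c ])) (to (defines (push c) i) refl))

        gd∈q : gd ∈ formulae q
        gd∈q = subst (λ t → φ i [ t ] ∈ formulae q) (proj₂ (moved c d))
          (proj₁ (proj₂ (proj₂ fixedPoint) a) (to (translate-∈ a q gc) gc∈q))

        φd∈p : φ i [ copy-tuple d ] ∈ formulae p
        φd∈p = from (translate-∈ g p (φ i [ copy-tuple d ])) (to (agrees d i) gd∈q)

  -- From monochromatic copies to fixed points

  module _ {M : Structure L ℓ} where

    Constant : FormulaOver M n → Pred (S n M) ℓ
    Constant ψ q = (a b : Automorphism M) →
      translate a ψ ∈ formulae q → translate b ψ ∈ formulae q

    ∈-·-translate : (g : Automorphism M) (q : S n M) (ψ : FormulaOver M n) (a : Automorphism M) →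
      translate a ψ ∈ formulae (g · q) ⇔ translate (≅-trans a (≅-sym g)) ψ ∈ formulae q
    ∈-·-translate g q ψ a = subst
      (λ φ → translate a ψ ∈ formulae (g · q) ⇔ φ ∈ formulae q)
      (translate-∘ a (≅-sym g) ψ) (∈-· g q (translate a ψ))

    -- Comparing the identity with `g` gives one inclusion; comparing it with the inverse of `g`
    -- gives the other.
    constant-everywhere⇒fixed : (q : S n M) → (∀ ψ → q ∈ Constant ψ) → q ∈ Fixed
    constant-everywhere⇒fixed q con g =
      (λ where (ψ , ψ∈q , refl) →
                 con ψ ≅-refl g (subst (_∈ formulae q) (sym (translate-id ψ)) ψ∈q)) ,
      (λ {ψ} ψ∈q → from (∈-· g q ψ)
        (con ψ ≅-refl (≅-sym g) (subst (_∈ formulae q) (sym (translate-id ψ)) ψ∈q)))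

    -- The finite approximation to `Constant`: only translates with all parameters in `l` are
    -- compared, and these a single monochromatic copy controls.
    ConstantOn : List (Carrier M) → FormulaOver M n → Pred (S n M) ℓ
    ConstantOn l ψ@(_ [ m̄ ]) q = (a b : Automorphism M) →
      toList (map (_≅_.to a) m̄) List⊆.⊆ l → toList (map (_≅_.to b) m̄) List⊆.⊆ l →
      translate a ψ ∈ formulae q → translate b ψ ∈ formulae q

    module Colouring (hom : Ultrahomogeneous M) (ramsey : EDRamsey M)
                     (p : S n M) {r : ℕ} (φ : Formula L (n + r)) (m̄ : Vec (Carrier M) r)
                     (l : List (Carrier M)) where

      open Realisation (realisation p)
      open _≼_ extension using (embed)

      A B : Structure L ℓ
      A = M ↾ (_∈ᵥ m̄)
      B = M ↾ (_∈ᵥ fromList l)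

      ā : Enumeration (Carrier A)
      ā = members m̄

      ψ : Formula L (n + size ā)
      ψ = reindex n (positions m̄) φ

      colour : {P : Set ℓ} → Dec P → Fin 2
      colour (yes _) = zero
      colour (no _)  = suc zero

      χ : Copies M A ā → Fin 2
      χ (t , _) = colour (em {N ⊨ ψ at (ē ++ map embed t)})

      ψ± : Fin 2 → Formula L (n + size ā)
      ψ± zero       = ψ
      ψ± (suc zero) = ¬′ ψ

      defines : ∀ c i → χ c ≡ i ⇔ N ⊨ ψ± i at (ē ++ map embed (proj₁ c))
      defines (t , _) = by em
        where
        by : (d : Dec (N ⊨ ψ at (ē ++ map embed t))) →
             ∀ i → colour d ≡ i ⇔ N ⊨ ψ± i at (ē ++ map embed t)
        by (yes h) zero       = mk⇔ (λ _ → h) (λ _ → refl)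
        by (yes h) (suc zero) = mk⇔ (λ ()) (λ ¬h → case ¬h h of λ ())
        by (no ¬h) zero       = mk⇔ (λ ()) (λ h → contradiction h ¬h)
        by (no ¬h) (suc zero) = mk⇔ (λ _ h → contradiction h ¬h) (λ _ → refl)

      monochromaticCopy : Σ[ P ∈ Pred (Carrier M) ℓ ] ((M ↾ P) ≅ B) ×
        (∀ (c d : Copies (M ↾ P) A ā) →
          χ (pushCopy (inclusion M P) A ā c) ≡ χ (pushCopy (inclusion M P) A ā d))
      monochromaticCopy = ramsey A (ā , inclusion M _) ā 2 (s≤s z≤n) B
        (members (fromList l) , inclusion M _) χ record
          { N = N ; extension = extension ; ē = ē ; φ = ψ± ; defines = defines }

      P : Pred (Carrier M) ℓ
      P = proj₁ monochromaticCopy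

      iso : (M ↾ P) ≅ B
      iso = proj₁ (proj₂ monochromaticCopy)

      -- The automorphism carries the monochromatic copy onto the elements of `l`, so `g · p`
      -- behaves on `l` as `p` does on the copy.
      extended : Σ[ g ∈ Automorphism M ] (∀ x → _≅_.to g (value x) ≡ value (_≅_.to iso x))
      extended = hom P (_∈ᵥ fromList l) (enumeration-≅ (≅-sym iso) (members (fromList l)))
        (members (fromList l)) iso

      g : Automorphism M
      g = proj₁ extended

      module G = _≅_ g

      from-iso : ∀ y → value (_≅_.from iso y) ≡ G.from (value y)
      from-iso y = trans (sym (G.strictlyInverseʳ _)) (cong G.from
        (trans (proj₂ extended (_≅_.from iso y)) (cong value (_≅_.strictlyInverseˡ iso y))))

      module _ (a : Automorphism M) (a⊆l : toList (map (_≅_.to a) m̄) List⊆.⊆ l) where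

        private module a = _≅_ a

        a-embedding : Embedding A B
        a-embedding = restrict (≅-embedding a) λ x x∈m̄ →
          Vec∈.∈-fromList⁺ (a⊆l (Vec∈.∈-toList⁺ (Vec∈.∈-map⁺ a.to x∈m̄)))

        -- Moving `m̄` into `l` by `a` embeds `A` in `B`; the inverse of `iso` then takes it into
        -- the monochromatic copy, where the inverse of `g` has been applied after `a`.
        copy : Copies (M ↾ P) A ā
        copy = _ , ≅-embedding (≅-sym iso) ∘ₑ a-embedding , refl

        pushed : Copies M A ā
        pushed = pushCopy (inclusion M P) A ā copy

        u : Vec (Carrier M) (size ā)
        u = map value (tuple ā)

        parameters-≡ : map (lookup (map embed (proj₁ pushed))) (positions m̄) ≡
                       map embed (map G.from (map a.to m̄))
        parameters-≡ = begin
          map (lookup (map embed (proj₁ pushed))) (positions m̄)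
            ≡⟨ map-select embed (proj₁ pushed) (positions m̄) ⟩
          map embed (map (lookup (proj₁ pushed)) (positions m̄))
            ≡⟨ cong (λ t → map embed (map (lookup t) (positions m̄)))
                 (trans (map-fusion (λ x → from-iso (Embedding.to a-embedding x)) (tuple ā))
                        (map-∘ (G.from ∘ a.to) value (tuple ā))) ⟩
          map embed (map (lookup (map (G.from ∘ a.to) u)) (positions m̄))
            ≡⟨ cong (map embed) (map-select (G.from ∘ a.to) u (positions m̄)) ⟩
          map embed (map (G.from ∘ a.to) (map (lookup u) (positions m̄)))
            ≡⟨ cong (map embed ∘ map (G.from ∘ a.to)) (positions-spec m̄) ⟩
          map embed (map (G.from ∘ a.to) m̄)
            ≡⟨ cong (map embed) (map-∘ G.from a.to m̄) ⟩
          map embed (map G.from (map a.to m̄)) ∎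
          where open ≡-Reasoning

        instance-⊨ : N ⊨ ψ at (ē ++ map embed (proj₁ pushed)) ⇔
                     N ⊨ φ at (ē ++ map embed (map G.from (map a.to m̄)))
        instance-⊨ = subst
          (λ t → N ⊨ ψ at (ē ++ map embed (proj₁ pushed)) ⇔ N ⊨ φ at (ē ++ t))
          parameters-≡ (reindex-⊨ N (positions m̄) φ ē (map embed (proj₁ pushed)))

        -- Colour zero means that `p` contains `φ` at the parameters obtained from `m̄` by `a`
        -- followed by the inverse of `g`; applying `g` turns this into a statement about `g · p`.
        colour-zero : χ pushed ≡ zero ⇔ translate a (φ [ m̄ ]) ∈ formulae (g · p)
        colour-zero = mk⇔
          (λ h → from (∈-· g p (φ [ map a.to m̄ ])) (from (realises g⁻¹aφ)
            (to instance-⊨ (to (defines pushed zero) h))))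
          (λ h → from (defines pushed zero) (from instance-⊨
            (to (realises g⁻¹aφ) (to (∈-· g p (φ [ map a.to m̄ ])) h))))
          where
          g⁻¹aφ : FormulaOver M n
          g⁻¹aφ = φ [ map G.from (map a.to m̄) ]

      constantOn : (g · p) ∈ ConstantOn l (φ [ m̄ ])
      constantOn a b a⊆l b⊆l h = to (colour-zero b b⊆l)
        (trans (proj₂ (proj₂ monochromaticCopy) (copy b b⊆l) (copy a a⊆l))
          (from (colour-zero a a⊆l) h))

    module _ (hom : Ultrahomogeneous M) (ramsey : EDRamsey M) where

      constant-in : {X : Pred (S n M) ℓ} → IsSubflow X → ∀ ψ → ∃[ q ] q ∈ X × q ∈ Constant ψ
      constant-in {n} {X} X-flow ψ@(φ [ m̄ ]) = q , q∈X , constant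
        where
        open IsSubflow X-flow

        U : Ultrafilter (List (Carrier M))
        U = proj₁ (cofinal-ultrafilter (Carrier M))

        open Ultrafilter U

        p : S n M
        p = proj₁ nonempty

        module Col l = Colouring hom ramsey p φ m̄ l

        q : S n M
        q = Limit.limit U λ l → Col.g l · p

        q∈X : q ∈ X
        q∈X = limit-closed closed U _ λ l → invariant (Col.g l) p (proj₂ nonempty)

        constant : q ∈ Constant ψ
        -- Almost every `l` contains the parameters of both translates, and constancy on such an `l`
        -- compares them.
        constant a b large = upward
          (λ {l} (sub , h) → Col.constantOn l a b (sub ∘ ∈-++⁺ˡ) (sub ∘ ∈-++⁺ʳ as) h)
          (intersection (proj₂ (cofinal-ultrafilter (Carrier M)) (as List.++ bs)) large)
          where
          as bs : List (Carrier M)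
          as = toList (map (_≅_.to a) m̄)
          bs = toList (map (_≅_.to b) m̄)

      -- A failure of constancy is witnessed by a translate of `ψ` and the negation of another,
      -- hence is an open condition. Acting by `g` only permutes the automorphisms indexing the
      -- translates.
      constant-isSubflow : {X : Pred (S n M) ℓ} → IsSubflow X → ∀ ψ →
                           IsSubflow (λ q → q ∈ X × q ∈ Constant ψ)
      constant-isSubflow {X = X} X-flow ψ = record
        { nonempty  = constant-in X-flow ψ
        ; closed    = closed′
        ; invariant = λ g q (q∈X , con) → invariant g q q∈X , λ a b h →
            from (∈-·-translate g q ψ b) (con _ _ (to (∈-·-translate g q ψ a) h))
        }
        where
        open IsSubflow X-flow

        Witness : S _ M → Set ℓ
        Witness q = Σ[ a ∈ Automorphism M ] Σ[ b ∈ Automorphism M ]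
          translate a ψ ∈ formulae q × notOver (translate b ψ) ∈ formulae q

        closed′ : Closed (λ q → q ∈ X × q ∈ Constant ψ)
        closed′ q q∉ with em {q ∈ X} | em {Witness q}
        ... | no q∉X | _ =
          let (φ , φ∈q , avoids) = closed q q∉X
          in φ , φ∈q , λ {q′} φ∈q′ (q′∈X , _) → avoids {q′} φ∈q′ q′∈X
        ... | yes q∈X | no none = contradiction (q∈X , λ a b h →
          [ id , (λ h′ → contradiction (a , b , h , h′) none) ]′ (complete q (translate b ψ))) q∉
        ... | yes _ | yes (a , b , h , h′) =
          ⋀ Δ , from (⋀-∈ q Δ) (h ∷ h′ ∷ []) , λ {q′} ⋀∈q′ (_ , con) →
            case to (⋀-∈ q′ Δ) ⋀∈q′ of λ where
              (k ∷ k′ ∷ []) → notOver-∉ q′ (translate b ψ) k′ (con a b k)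
          where
          Δ = translate a ψ ∷ notOver (translate b ψ) ∷ []

      module _ {X : Pred (S n M) ℓ} (X-flow : IsSubflow X) where

        ConstantAll : List (FormulaOver M n) → Pred (S n M) ℓ
        ConstantAll []      = X
        ConstantAll (ψ ∷ Δ) q = q ∈ ConstantAll Δ × q ∈ Constant ψ

        -- Each formula is treated inside the subflow already obtained, so constancy for the earlier
        -- ones persists.
        constantAll-isSubflow : ∀ Δ → IsSubflow (ConstantAll Δ)
        constantAll-isSubflow []      = X-flow
        constantAll-isSubflow (ψ ∷ Δ) = constant-isSubflow (constantAll-isSubflow Δ) ψ

        constantAll-⊆ : ∀ Δ {q} → q ∈ ConstantAll Δ → q ∈ X
        constantAll-⊆ []      h       = h
        constantAll-⊆ (_ ∷ Δ) (h , _) = constantAll-⊆ Δ h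

        constantAll-constant : ∀ {Δ ψ q} → q ∈ ConstantAll Δ → ψ List∈.∈ Δ → q ∈ Constant ψ
        constantAll-constant (_ , con) (here refl) = con
        constantAll-constant (h , _)   (there m)   = constantAll-constant h m

        fixedPoint-in : ∃[ q ] q ∈ X × q ∈ Fixed
        fixedPoint-in = q ,
          limit-closed (IsSubflow.closed X-flow) U p (λ Δ → constantAll-⊆ Δ (p-∈ Δ)) ,
          -- Almost every `Δ` contains the given `ψ`, so almost every `p Δ` is constant along its
          -- orbit.
          constant-everywhere⇒fixed q λ ψ a b large → upward
            (λ {Δ} (sub , h) → constantAll-constant {Δ} (p-∈ Δ) (sub (here refl)) a b h)
            (intersection (proj₂ (cofinal-ultrafilter (FormulaOver M n)) (ψ ∷ [])) large)
          where
          U : Ultrafilter (List (FormulaOver M n))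
          U = proj₁ (cofinal-ultrafilter (FormulaOver M n))

          open Ultrafilter U

          p : List (FormulaOver M n) → S n M
          p Δ = proj₁ (IsSubflow.nonempty (constantAll-isSubflow Δ))

          p-∈ : ∀ Δ → p Δ ∈ ConstantAll Δ
          p-∈ Δ = proj₂ (IsSubflow.nonempty (constantAll-isSubflow Δ))

          q : S n M
          q = Limit.limit U p

      ramsey⇒fpt : FPT M
      ramsey⇒fpt n _ X X-flow = fixedPoint-in X-flow

theorem5p1 : (∀ {a : Level} → ExcludedMiddle a) →
    (∀ {a b : Level} → Extensionality a b) →
    ∀ {ℓ : Level} {L : Language} (M : Structure L ℓ) →
    Ultrahomogeneous M →
    (FPT M → EDRamsey M) ×
    (AgeCountable M → (EDRamsey M ⇔ FPT M))
theorem5p1 em ext M hom = fpt⇒ramsey hom , λ _ → mk⇔ (ramsey⇒fpt hom) (fpt⇒ramsey hom)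
  where open Classical em ext
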